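{- Every $4$-regular connected circulant graph $\Gamma$ of even order whose two jumps have different parity has property $Q_2$ with respect to some Hamilton cycle decomposition of it; that is, $\Gamma$ has a decomposition into two Hamilton cycles $H_1,H_2$ for which $\Gamma$ contains an odd alternating $4$-cycle.
   Context: A $4$-regular circulant of order $n$ is $Circ(n;\{a,b\})$ with vertex set $\mathbb{Z}_n$ and edges $x(x\pm a)$, $x(x\pm b)$, where $a,b$ (the jumps) are distinct elements of $\{1,\ldots,\lfloor n/2\rfloor\}$ with $2a\ne0$, $2b\neq0$ in $\mathbb{Z}_n$. For a decomposition $\{H_1,H_2\}$ of a $4$-regular graph of even order into two Hamilton cycles, a $4$-cycle $(w\,x\,y\,z)$ is alternating if $wx,yz$ lie in one of $H_1,H_2$ and $xy,zw$ in the other; it is an odd alternating $4$-cycle if moreover $w$ and $y$ (or $x$ and $z$) are at odd distance along each of $H_1$ and $H_2$. Property $Q_2$ means such an odd alternating $4$-cycle exists. -}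

module Defs where

open import Data.Nat using (ℕ; zero; suc; _+_; _*_; _∸_; _≤_; _⊓_; ∣_-_∣; NonZero)
open import Data.Nat.DivMod using (_%_; _/_)
open import Data.Fin using (Fin; toℕ)
open import Data.Product using (Σ; ∃; _×_; _,_)
open import Data.Sum using (_⊎_)
open import Data.Empty using (⊥)
open import Relation.Binary.PropositionalEquality using (_≡_; _≢_)
open import Function.Definitions using (Injective)

-- The circulant Circ(n; {a, b}) on vertex set ℤ_n (represented by Fin n,
-- residue x ↔ toℕ x).  Edges: x ~ x ± a, x ~ x ± b (mod n).

PlusJump : (n : ℕ) .{{_ : NonZero n}} → ℕ → Fin n → Fin n → Set
PlusJump n s x y = (toℕ x + s) % n ≡ toℕ y

Adj : (n : ℕ) .{{_ : NonZero n}} → (a b : ℕ) → Fin n → Fin n → Set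
Adj n a b x y =
  PlusJump n a x y ⊎ PlusJump n a y x ⊎ PlusJump n b x y ⊎ PlusJump n b y x

FourRegularJumps : (n : ℕ) .{{_ : NonZero n}} → (a b : ℕ) → Set
FourRegularJumps n a b =
  1 ≤ a × a ≤ n / 2 × 1 ≤ b × b ≤ n / 2 × a ≢ b ×
  (2 * a) % n ≢ 0 × (2 * b) % n ≢ 0

data Reach (n : ℕ) .{{_ : NonZero n}} (a b : ℕ) (x : Fin n) : Fin n → Set where
  here : Reach n a b x x
  step : ∀ {y z} → Reach n a b x y → Adj n a b y z → Reach n a b x z

Connected : (n : ℕ) .{{_ : NonZero n}} → (a b : ℕ) → Set
Connected n a b = ∀ x y → Reach n a b x y

-- Hamilton cycles.  A Hamilton cycle is given by a cyclic ordering
-- H : Fin n → Fin n of all vertices (injective, hence a bijection),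
-- consecutive positions i, i+1 (mod n) being adjacent.

Consec : (n : ℕ) .{{_ : NonZero n}} → Fin n → Fin n → Set
Consec n i j = (toℕ i + 1) % n ≡ toℕ j

IsHamCycle : (n : ℕ) .{{_ : NonZero n}} → (a b : ℕ) → (Fin n → Fin n) → Set
IsHamCycle n a b H =
  Injective _≡_ _≡_ H × (∀ i j → Consec n i j → Adj n a b (H i) (H j))

CycEdge : (n : ℕ) .{{_ : NonZero n}} → (Fin n → Fin n) → Fin n → Fin n → Set
CycEdge n H x y = Σ (Fin n) λ i → Σ (Fin n) λ j → Consec n i j ×
  ((H i ≡ x × H j ≡ y) ⊎ (H i ≡ y × H j ≡ x))

IsHamDecomp : (n : ℕ) .{{_ : NonZero n}} → (a b : ℕ) → (H₁ H₂ : Fin n → Fin n) → Set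
IsHamDecomp n a b H₁ H₂ =
  IsHamCycle n a b H₁ × IsHamCycle n a b H₂ ×
  (∀ x y → Adj n a b x y → CycEdge n H₁ x y ⊎ CycEdge n H₂ x y) ×
  (∀ x y → CycEdge n H₁ x y → CycEdge n H₂ x y → ⊥)

cycDist : (n : ℕ) → {m : ℕ} → Fin m → Fin m → ℕ
cycDist n i j = ∣ toℕ i - toℕ j ∣ ⊓ (n ∸ ∣ toℕ i - toℕ j ∣)

OddDistAlong : (n : ℕ) .{{_ : NonZero n}} → (Fin n → Fin n) → Fin n → Fin n → Set
OddDistAlong n H u v = Σ (Fin n) λ i → Σ (Fin n) λ j →
  H i ≡ u × H j ≡ v × cycDist n i j % 2 ≡ 1

AltFourCycle : (n : ℕ) .{{_ : NonZero n}} → (H₁ H₂ : Fin n → Fin n) →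
               (w x y z : Fin n) → Set
AltFourCycle n H₁ H₂ w x y z =
  (w ≢ x × w ≢ y × w ≢ z × x ≢ y × x ≢ z × y ≢ z) ×
  ((CycEdge n H₁ w x × CycEdge n H₁ y z × CycEdge n H₂ x y × CycEdge n H₂ z w) ⊎
   (CycEdge n H₂ w x × CycEdge n H₂ y z × CycEdge n H₁ x y × CycEdge n H₁ z w))

OddAltFourCycle : (n : ℕ) .{{_ : NonZero n}} → (H₁ H₂ : Fin n → Fin n) →
                  (w x y z : Fin n) → Set
OddAltFourCycle n H₁ H₂ w x y z =
  AltFourCycle n H₁ H₂ w x y z ×
  ((OddDistAlong n H₁ w y × OddDistAlong n H₂ w y) ⊎
   (OddDistAlong n H₁ x z × OddDistAlong n H₂ x z))

Q₂ : (n : ℕ) .{{_ : NonZero n}} → (H₁ H₂ : Fin n → Fin n) → Set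
Q₂ n H₁ H₂ = Σ (Fin n) λ w → Σ (Fin n) λ x → Σ (Fin n) λ y → Σ (Fin n) λ z →
  OddAltFourCycle n H₁ H₂ w x y z

{-# OPTIONS --safe #-}
module Submission where

-- Let {s , t} = {a , b}, where ⟨s⟩ has R cosets, ⟨t⟩ has C cosets and R > C; exactly one of R, C is
-- even. Write (i , j) for the vertex i t + j s, so that rows are cosets of ⟨s⟩ and columns modulo C
-- are cosets of ⟨t⟩. Start from the 2-factor of all s-edges and the 2-factor of all t-edges and
-- exchange the edges of one square between any two consecutive rows: first the squares
-- with lower left corners (i , i), i ≤ D, climbing through all cosets of ⟨t⟩, then
-- squares zigzagging between columns D and D + 1 (D is even). For R even take D = C − 1 and leave
-- out the square between the last row and the first; for R odd take D = C − 2 and use all R of them.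
-- Connectedness: a two-valued function that is constant along the edges of a class is constant.
-- For the t-class the zigzag acts like a single square, and then both classes are staircases
-- which either open a new coset at their end or close up after an odd number of squares.
-- Odd square: let c₁, c₂ be the parities of the positions along the two cycles. If c₂ flipped
-- across both the first and the last square, then it would flip along every t-edge, which the
-- relation between C s and ⟨t⟩ forbids. By the same argument c₁ does not flip across these squares,
-- except when R and the row length are both even; then c₁ is the chessboard colouring, and
-- an unexchanged square between the last row and the first is odd.

open import Defs
open import Data.Nat using (ℕ; zero; suc; pred; parity; _+_; _*_; _∸_; ∣_-_∣; _≤_; _<_; z≤n; s≤s; z<s; s<s; NonZero; _≤?_; _<?_; >-nonZero; ≢-nonZero; ≢-nonZero⁻¹)
open import Data.Nat.Properties using (≤-refl; ≤-trans; ≤-antisym; ≤-pred; <-cmp; <-irrefl; <-trans; <⇒≤; ≤-<-trans; <-≤-trans; ≤∧≢⇒<; ≰⇒>; ≮⇒≥; n<1+n; n≤1+n; ≤-reflexive; m+n∸m≡n; m+1+n≰m; m≤n⇒∃[o]m+o≡n; m≤m+n; m≤n+m; m<n⇒m<1+n; m<1+n⇒m≤n; m<1+n⇒m<n∨m≡n; n≤0⇒n≡0; +-comm; +-assoc; +-identityʳ; +-suc; +-cancelˡ-≡; +-cancelʳ-≡; +-monoˡ-≤; +-mono-≤; +-mono-<-≤; +-mono-≤-<; +-monoʳ-≤; +-cancelˡ-≤; *-comm; *-assoc; *-identityˡ; *-identityʳ; *-zeroʳ; *-distribʳ-+; *-cancelʳ-≡; suc-injective; suc-pred; m∸n+n≡m;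 m+[n∸m]≡n; ⊓-sel; ∣m-n∣≤m⊔n; ⊔-lub; 1+n≢0; 0≢1+n; 1+n≢n; anyUpTo?) renaming (_≟_ to _≟ᴺ_)
open import Data.Nat.DivMod using (_%_; _/_; _mod_; m≡m%n+[m/n]*n; [m+kn]%n≡m%n; m%n<n; m<n⇒m%n≡m; n%n≡0; m/n*n≤m)
open import Data.Nat.Divisibility using (_∣_; divides; ∣-trans; ∣m+n∣m⇒∣n; ∣n⇒∣m*n; m∣m*n; n∣m*n; ∣1⇒≡1; ∣⇒≤; m%n≡0⇒n∣m; *-cancelʳ-∣)
open import Data.Nat.GCD using (gcd; gcd[m,n]∣m; gcd[m,n]∣n; gcd-greatest; gcd-GCD; gcd[m,n]≢0; module Bézout)
open import Data.Nat.Coprimality using (Coprime; coprime-Bézout; coprime-divisor)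
open import Data.Nat.Tactic.RingSolver using (solve-∀)
open import Data.Parity.Base using (Parity; 0ℙ; 1ℙ; _⁻¹) renaming (_+_ to _⊞_; _*_ to _⊠_)
open import Data.Parity.Properties using (+-homo-+; *-homo-*; p≢p⁻¹; ⁻¹-involutive; ⁻¹-injective) renaming (_≟_ to _≟ℙ_)
import Data.Parity.Properties as ℙ
open import Data.Fin using (Fin; toℕ; fromℕ<)
open import Data.Fin.Properties using (toℕ-injective; toℕ<n; toℕ-fromℕ<; pigeonhole; injective⇒≤; any?; _≟_)
open import Data.Product using (Σ; ∃; _×_; _,_; proj₁; proj₂)
import Data.Sum
open import Data.Sum using (_⊎_; inj₁; inj₂; [_,_]′)
open import Data.Empty using (⊥; ⊥-elim)
open import Function using (_∘_; id; case_of_)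
open import Function.Definitions using (Injective)
open import Relation.Nullary using (¬_; Dec; yes; no; contradiction)
open import Relation.Nullary.Decidable using (_×-dec_; _⊎-dec_)
open import Relation.Binary.Definitions using (tri<; tri≈; tri>)
open import Relation.Binary.PropositionalEquality using (_≡_; _≢_; refl; sym; trans; cong; cong₂; subst; ≢-sym; module ≡-Reasoning)

-- Each exchanged square acts on both classes at once. Joining the `R` cosets of ⟨s⟩ takes at least
-- `R - 1` squares, whereas about `C` of them already join the cosets of ⟨t⟩. The zigzag is there to
-- spend this surplus without disturbing the second class.
--
-- A staircase that closes up needs an odd number of squares because the two strands running through
-- it change places at every coset; this is why `D` and `K` are kept even.
--
-- The first and the last square are singled out because the others offer no choice: strictly inside
-- the zigzag, `H₂` walks around the side of each square in an odd number of steps, so `c₂` flips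
-- there anyway, and along the diagonal a flip at one square forces a flip at the next.
--
-- If `R` and the row length are even, the single broken edge of row 0 is forced to flip `c₁`, and
-- this spreads to all rows. Then no exchanged square can be odd, and the gap left between the last
-- row and the first is what supplies one.

abstract
  least : ∀ {P : ℕ → Set} → (∀ k → Dec (P k)) → ∀ {m} → P m →
    ∃ λ k → P k × (∀ {l} → l < k → ¬ P l)
  least {P} P? {m} pm = [ id , (λ none → m , pm , none) ]′ (search m)
    where
    search : ∀ m → (∃ λ k → P k × (∀ {l} → l < k → ¬ P l)) ⊎ (∀ {l} → l < m → ¬ P l)
    search zero = inj₂ λ ()
    search (suc m) with search m
    ... | inj₁ found = inj₁ found
    ... | inj₂ none with P? m
    ...   | yes pm = inj₁ (m , pm , none)
    ...   | no ¬pm = inj₂ λ {l} l<1+m pl →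
              [ (λ l<m → none l<m pl) , (λ { refl → ¬pm pl }) ]′ (m<1+n⇒m<n∨m≡n l<1+m)

-- Parity and congruences

parity-suc : ∀ m → parity (suc m) ≡ parity m ⁻¹
parity-suc m = +-homo-+ 1 m

parity-2* : ∀ m → parity (m * 2) ≡ 0ℙ
parity-2* m = trans (cong parity (*-comm m 2)) (*-homo-* 2 m)

parity-%2 : ∀ m → parity (m % 2) ≡ parity m
parity-%2 m = begin
  parity (m % 2)                        ≡⟨ sym (ℙ.+-identityʳ _) ⟩
  parity (m % 2) ⊞ 0ℙ                   ≡⟨ cong (parity (m % 2) ⊞_) (sym (parity-2* (m / 2))) ⟩
  parity (m % 2) ⊞ parity (m / 2 * 2)   ≡⟨ sym (+-homo-+ (m % 2) (m / 2 * 2)) ⟩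
  parity (m % 2 + m / 2 * 2)            ≡⟨ cong parity (sym (m≡m%n+[m/n]*n m 2)) ⟩
  parity m                              ∎
  where
  open ≡-Reasoning

%2≡0⇒even : ∀ m → m % 2 ≡ 0 → parity m ≡ 0ℙ
%2≡0⇒even m eq = trans (sym (parity-%2 m)) (cong parity eq)

odd⇒%2≡1 : ∀ m → parity m ≡ 1ℙ → m % 2 ≡ 1
odd⇒%2≡1 m eq with m % 2 | m%n<n m 2 | parity-%2 m
... | 0 | _ | e = contradiction (trans e eq) λ ()
... | 1 | _ | _ = refl
... | suc (suc _) | s≤s (s≤s ()) | _

≢⇒⁻¹ : ∀ {p q : Parity} → q ≢ p → q ≡ p ⁻¹
≢⇒⁻¹ {0ℙ} {0ℙ} q≢p = contradiction refl q≢p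
≢⇒⁻¹ {0ℙ} {1ℙ} _   = refl
≢⇒⁻¹ {1ℙ} {0ℙ} _   = refl
≢⇒⁻¹ {1ℙ} {1ℙ} q≢p = contradiction refl q≢p

-- Congruence of naturals, in a form in which every fact is a semiring identity.
record _≈_mod_ (x y m : ℕ) : Set where
  constructor cong-by
  field
    p q : ℕ
    eq  : x + p * m ≡ y + q * m

≈-refl : ∀ {m x} → x ≈ x mod m
≈-refl = cong-by 0 0 refl

≈-reflexive : ∀ {m x y} → x ≡ y → x ≈ y mod m
≈-reflexive refl = ≈-refl

≈-sym : ∀ {m x y} → x ≈ y mod m → y ≈ x mod m
≈-sym (cong-by p q eq) = cong-by q p (sym eq)

≈-+ : ∀ {m x y x′ y′} → x ≈ y mod m → x′ ≈ y′ mod m → (x + x′) ≈ (y + y′) mod m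
≈-+ {m} {x} {y} {x′} {y′} (cong-by p q eq) (cong-by p′ q′ eq′) = cong-by (p + p′) (q + q′) (begin
  x + x′ + (p + p′) * m           ≡⟨ shuffle x x′ p p′ m ⟩
  (x + p * m) + (x′ + p′ * m)     ≡⟨ cong₂ _+_ eq eq′ ⟩
  (y + q * m) + (y′ + q′ * m)     ≡⟨ sym (shuffle y y′ q q′ m) ⟩
  y + y′ + (q + q′) * m           ∎)
  where
  open ≡-Reasoning
  shuffle : ∀ x x′ p p′ m → x + x′ + (p + p′) * m ≡ (x + p * m) + (x′ + p′ * m)
  shuffle = solve-∀

≈-cancel : ∀ {m x y} k l → (x + k) ≈ (y + l) mod m → k ≈ l mod m → x ≈ y mod m
≈-cancel {m} {x} {y} k l (cong-by p q eq) (cong-by p′ q′ eq′) =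
  cong-by (p + q′) (q + p′) (+-cancelʳ-≡ (k + p′ * m) _ _ (begin
    x + (p + q′) * m + (k + p′ * m)         ≡⟨ shuffle x p q′ k p′ m ⟩
    (x + k + p * m) + (p′ * m + q′ * m)     ≡⟨ cong (_+ (p′ * m + q′ * m)) eq ⟩
    (y + l + q * m) + (p′ * m + q′ * m)     ≡⟨ shuffle′ y l q p′ q′ m ⟩
    y + (q + p′) * m + (l + q′ * m)         ≡⟨ cong (y + (q + p′) * m +_) (sym eq′) ⟩
    y + (q + p′) * m + (k + p′ * m)         ∎))
  where
  open ≡-Reasoning
  shuffle : ∀ x p q′ k p′ m → x + (p + q′) * m + (k + p′ * m) ≡ (x + k + p * m) + (p′ * m + q′ * m)
  shuffle = solve-∀
  shuffle′ : ∀ y l q p′ q′ m → (y + l + q * m) + (p′ * m + q′ * m) ≡ y + (q + p′) * m + (l + q′ * m)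
  shuffle′ = solve-∀

≈-trans : ∀ {m x y z} → x ≈ y mod m → y ≈ z mod m → x ≈ z mod m
≈-trans {m} {x} {y} {z} x≈y y≈z = ≈-cancel y y
  (subst (λ w → (x + y) ≈ w mod m) (+-comm y z) (≈-+ x≈y y≈z)) ≈-refl

≈-* : ∀ {m x y} k → x ≈ y mod m → (x * k) ≈ (y * k) mod m
≈-* {m} {x} {y} k (cong-by p q eq) = cong-by (p * k) (q * k) (begin
  x * k + p * k * m   ≡⟨ shuffle x k p m ⟩
  (x + p * m) * k     ≡⟨ cong (_* k) eq ⟩
  (y + q * m) * k     ≡⟨ sym (shuffle y k q m) ⟩
  y * k + q * k * m   ∎)
  where
  open ≡-Reasoning
  shuffle : ∀ x k p m → x * k + p * k * m ≡ (x + p * m) * k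
  shuffle = solve-∀

≈-*ˡ : ∀ {m x y} k → x ≈ y mod m → (k * x) ≈ (k * y) mod m
≈-*ˡ {m} {x} {y} k x≈y = subst (_≈ (k * y) mod m) (*-comm x k) (subst ((x * k) ≈_mod m) (*-comm y k) (≈-* k x≈y))

∣⇒≈0 : ∀ {m x} → m ∣ x → x ≈ 0 mod m
∣⇒≈0 (divides q eq) = cong-by 0 q (trans (+-identityʳ _) eq)

≈0⇒∣ : ∀ {m x} → x ≈ 0 mod m → m ∣ x
≈0⇒∣ {m} {x} (cong-by p q eq) = ∣m+n∣m⇒∣n (subst (m ∣_) (trans (sym eq) (+-comm x (p * m))) (n∣m*n q)) (n∣m*n p)

≈-∣ : ∀ {d m x y} → d ∣ m → x ≈ y mod m → x ≈ y mod d
≈-∣ {d} {x = x} {y} (divides k refl) (cong-by p q eq) =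
  cong-by (p * k) (q * k) (trans (cong (x +_) (*-assoc p k d)) (trans eq (cong (y +_) (sym (*-assoc q k d)))))

module _ (m : ℕ) .{{_ : NonZero m}} where

  %-≈ : ∀ x → (x % m) ≈ x mod m
  %-≈ x = cong-by (x / m) 0 (trans (sym (m≡m%n+[m/n]*n x m)) (sym (+-identityʳ x)))

  ≈⇒%≡ : ∀ {x y} → x ≈ y mod m → x % m ≡ y % m
  ≈⇒%≡ {x} {y} (cong-by p q eq) = trans (sym ([m+kn]%n≡m%n x p m)) (trans (cong (_% m) eq) ([m+kn]%n≡m%n y q m))

  %≡⇒≈ : ∀ {x y} → x % m ≡ y % m → x ≈ y mod m
  %≡⇒≈ {x} {y} eq = ≈-trans (≈-sym (%-≈ x)) (≈-trans (≈-reflexive eq) (%-≈ y))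

≈-parity : ∀ {m x y} → parity m ≡ 0ℙ → x ≈ y mod m → parity x ≡ parity y
≈-parity {m} {x} {y} even-m (cong-by p q eq) = trans (sym (absorb x p)) (trans (cong parity eq) (absorb y q))
  where
  absorb : ∀ x p → parity (x + p * m) ≡ parity x
  absorb x p = begin
    parity (x + p * m)                 ≡⟨ +-homo-+ x (p * m) ⟩
    parity x ⊞ parity (p * m)          ≡⟨ cong (parity x ⊞_) (*-homo-* p m) ⟩
    parity x ⊞ (parity p ⊠ parity m)   ≡⟨ cong (λ z → parity x ⊞ (parity p ⊠ z)) even-m ⟩
    parity x ⊞ (parity p ⊠ 0ℙ)         ≡⟨ cong (parity x ⊞_) (ℙ.*-zeroʳ (parity p)) ⟩
    parity x ⊞ 0ℙ                      ≡⟨ ℙ.+-identityʳ (parity x) ⟩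
    parity x                           ∎
    where open ≡-Reasoning

-- Hamilton cycles of 2-regular graphs

record HamiltonCycle (n : ℕ) .{{_ : NonZero n}} (E : Fin n → Fin n → Set) : Set where
  field
    cycle     : Fin n → Fin n
    injective : Injective _≡_ _≡_ cycle
    edge      : ∀ i j → Consec n i j → E (cycle i) (cycle j)
    covers    : ∀ {u v} → E u v → CycEdge n cycle u v
    position  : Fin n → Fin n
    cycle-position : ∀ v → cycle (position v) ≡ v

-- "Connected" is the statement that a two-valued function which is invariant along the edges
-- is constant.
module TwoRegular (n : ℕ) .{{_ : NonZero n}} (N₀ N₁ : Fin n → Fin n)
  (N₀≢N₁ : ∀ v → N₀ v ≢ N₁ v) (N₀-irr : ∀ v → N₀ v ≢ v) (N₁-irr : ∀ v → N₁ v ≢ v)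
  (sym₀ : ∀ v → N₀ (N₀ v) ≡ v ⊎ N₁ (N₀ v) ≡ v) (sym₁ : ∀ v → N₀ (N₁ v) ≡ v ⊎ N₁ (N₁ v) ≡ v)
  (connected : ∀ (f : Fin n → Parity) → (∀ v → f (N₀ v) ≡ f v) → (∀ v → f (N₁ v) ≡ f v) →
    ∀ u v → f u ≡ f v)
  where

  E : Fin n → Fin n → Set
  E u v = N₀ u ≡ v ⊎ N₁ u ≡ v

  E-sym : ∀ {u v} → E u v → E v u
  E-sym {u} (inj₁ refl) = sym₀ u
  E-sym {u} (inj₂ refl) = sym₁ u

  E-irr : ∀ {u v} → E u v → u ≢ v
  E-irr {u} (inj₁ refl) eq = N₀-irr u (sym eq)
  E-irr {u} (inj₂ refl) eq = N₁-irr u (sym eq)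

  origin : Fin n
  origin = 0 mod n

  private
    other : ∀ u v → E v u → Fin n
    other u v (inj₁ _) = N₁ v
    other u v (inj₂ _) = N₀ v

    E-other : ∀ u v (e : E v u) → E v (other u v e)
    E-other u v (inj₁ _) = inj₂ refl
    E-other u v (inj₂ _) = inj₁ refl

    other-≢ : ∀ u v (e : E v u) → u ≢ other u v e
    other-≢ u v (inj₁ refl) eq = N₀≢N₁ v eq
    other-≢ u v (inj₂ refl) eq = N₀≢N₁ v (sym eq)

    other-only : ∀ u v (e : E v u) {w} → E v w → w ≡ u ⊎ w ≡ other u v e
    other-only u v (inj₁ refl) (inj₁ refl) = inj₁ refl
    other-only u v (inj₁ refl) (inj₂ refl) = inj₂ refl
    other-only u v (inj₂ refl) (inj₁ refl) = inj₂ refl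
    other-only u v (inj₂ refl) (inj₂ refl) = inj₁ refl

    -- A walk that never turns back: a state holds the current vertex, the next one and the edge
    -- back, which tells `other` how to leave the next vertex.
    state : ℕ → Σ (Fin n) λ u → Σ (Fin n) λ v → E v u
    state zero    = origin , N₀ origin , sym₀ origin
    state (suc k) = let (u , v , e) = state k in v , other u v e , E-sym (E-other u v e)

    x : ℕ → Fin n
    x k = proj₁ (state k)

    x-edge : ∀ k → E (x k) (x (suc k))
    x-edge k = E-sym (proj₂ (proj₂ (state k)))

    x-skip : ∀ k → x k ≢ x (2 + k)
    x-skip k = let (u , v , e) = state k in other-≢ u v e

    x-only : ∀ k {w} → E (x (suc k)) w → w ≡ x k ⊎ w ≡ x (2 + k)
    x-only k = let (u , v , e) = state k in other-only u v e

    Repeat : ℕ → Set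
    Repeat j = ∃ λ i → i < j × x i ≡ x j

    some-repeat : ∃ Repeat
    some-repeat = let (i , j , i<j , eq) = pigeonhole (n<1+n n) (x ∘ toℕ) in toℕ j , toℕ i , i<j , eq

    first-repeat : ∃ λ j → Repeat j × (∀ {l} → l < j → ¬ Repeat l)
    first-repeat = least (λ j → anyUpTo? (λ i → x i ≟ x j) j) (proj₂ some-repeat)

    period : ℕ
    period = proj₁ first-repeat

    no-repeat : ∀ {i j} → i < j → j < period → x i ≢ x j
    no-repeat i<j j<period eq = proj₂ (proj₂ first-repeat) j<period (_ , i<j , eq)

    x-injective : ∀ {i j} → i < period → j < period → x i ≡ x j → i ≡ j
    x-injective {i} {j} i< j< eq with <-cmp i j
    ... | tri< i<j _ _ = contradiction eq (no-repeat i<j j<)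
    ... | tri≈ _ i≡j _ = i≡j
    ... | tri> _ _ j<i = contradiction (sym eq) (no-repeat j<i i<)

    -- The predecessor of the repeated vertex would otherwise be an earlier repetition.
    closes : ∀ j → (∀ {l} → l < j → ¬ Repeat l) → Repeat j → x 0 ≡ x j
    closes (suc j) _ (zero , _ , eq) = eq
    closes (suc j) min (suc i , s<s i<j , eq) with x-only i (subst (λ w → E w (x j)) (sym eq) (E-sym (x-edge j)))
    ... | inj₁ e = contradiction (i , i<j , sym e) (min (n<1+n j))
    ... | inj₂ e with <-cmp (2 + i) j
    ...   | tri< 2+i<j _ _ = contradiction (2 + i , 2+i<j , sym e) (min (n<1+n j))
    ...   | tri≈ _ refl _ = contradiction eq (x-skip (suc i))
    ...   | tri> _ _ (s≤s j≤1+i) with ≤-antisym i<j j≤1+i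
    ...     | refl = contradiction eq (E-irr (x-edge (suc i)))

    x-period : x 0 ≡ x period
    x-period = closes period (proj₂ (proj₂ first-repeat)) (proj₁ (proj₂ first-repeat))

    period≢ : ∀ {k} → x 0 ≢ x k → period ≢ k
    period≢ x0≢xk refl = x0≢xk x-period

    2<period : 2 < period
    2<period with period in eq | proj₂ (proj₁ (proj₂ first-repeat))
    ... | 0 | () , _
    ... | 1 | _ = contradiction eq (period≢ (E-irr (x-edge 0)))
    ... | 2 | _ = contradiction eq (period≢ (x-skip 0))
    ... | suc (suc (suc _)) | _ = s≤s (s≤s (s≤s z≤n))

    last : ℕ
    last = pred period

    suc-last : suc last ≡ period
    suc-last = suc-pred period {{>-nonZero (<-trans z<s 2<period)}}

    last<period : last < period
    last<period = subst (last <_) suc-last (n<1+n last)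

    last-edge : E (x last) (x 0)
    last-edge = subst (E (x last)) (trans (cong x suc-last) (sym x-period)) (x-edge last)

    -- The closing edge ends in one of the two neighbours of `x 0`. The neighbour `N₀ origin` is
    -- `x 1`, which would be repeated too early.
    x-last : x last ≡ N₁ origin
    x-last with E-sym last-edge
    ... | inj₂ e = sym e
    ... | inj₁ e = contradiction (x-injective (<-trans (n<1+n 1) 2<period) last<period e)
                     λ 1≡last → <-irrefl (trans (cong suc 1≡last) suc-last) 2<period

    Visited : Fin n → Set
    Visited v = ∃ λ k → k < period × x k ≡ v

    visited? : ∀ v → Dec (Visited v)
    visited? v = anyUpTo? (λ k → x k ≟ v) period

    visited-step : ∀ {u v} → E u v → Visited u → Visited v
    visited-step (inj₁ refl) (zero , _ , refl) = 1 , <-trans (n<1+n 1) 2<period , refl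
    visited-step (inj₂ refl) (zero , _ , refl) = last , last<period , x-last
    visited-step e (suc k , k< , refl) with x-only k e
    ... | inj₁ refl = k , <-trans (n<1+n k) k< , refl
    ... | inj₂ refl with 2 + k <? period
    ...   | yes 2+k< = 2 + k , 2+k< , refl
    ...   | no  2+k≮ = 0 , <-trans z<s 2<period , trans x-period (cong x (≤-antisym (≮⇒≥ 2+k≮) k<))

    -- The visited vertices are closed under both neighbour maps, so connectedness, applied to this
    -- function, makes the cycle spanning.
    indicator : Fin n → Parity
    indicator v with visited? v
    ... | yes _ = 1ℙ
    ... | no  _ = 0ℙ

    indicator-step : ∀ {u v} → E u v → indicator v ≡ indicator u
    indicator-step {u} {v} e with visited? u | visited? v
    ... | yes _ | yes _ = refl
    ... | yes a | no ¬b = contradiction (visited-step e a) ¬b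
    ... | no ¬a | yes b = contradiction (visited-step (E-sym e) b) ¬a
    ... | no  _ | no  _ = refl

    all-visited : ∀ v → Visited v
    all-visited v with visited? origin | visited? v | connected indicator (λ v → indicator-step (inj₁ refl))
                         (λ v → indicator-step (inj₂ refl)) origin v
    ... | _     | yes b | _ = b
    ... | no ¬a | no _  | _ = contradiction (0 , <-trans z<s 2<period , refl) ¬a
    ... | yes _ | no ¬b | e with visited? origin | visited? v
    ...   | no ¬a | _     = contradiction (0 , <-trans z<s 2<period , refl) ¬a
    ...   | yes _ | yes b = b
    ...   | yes _ | no  _ = contradiction e λ ()

    period≡n : period ≡ n
    period≡n = ≤-antisym
      (injective⇒≤ {f = λ (i : Fin period) → x (toℕ i)} λ {i} {j} eq →
        toℕ-injective (x-injective (toℕ<n i) (toℕ<n j) eq))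
      (injective⇒≤ {f = λ v → fromℕ< (proj₁ (proj₂ (all-visited v)))} λ {u} {v} eq →
        let (k , k< , xk≡u) = all-visited u
            (l , l< , xl≡v) = all-visited v
        in trans (sym xk≡u) (trans (cong x (trans (sym (toℕ-fromℕ< k<)) (trans (cong toℕ eq) (toℕ-fromℕ< l<)))) xl≡v))

    H : Fin n → Fin n
    H i = x (toℕ i)

    H-fromℕ< : ∀ {k} (k<n : k < n) → H (fromℕ< k<n) ≡ x k
    H-fromℕ< k<n = cong x (toℕ-fromℕ< k<n)

    consecutive : ∀ {k} (k<n : k < n) (1+k<n : suc k < n) → Consec n (fromℕ< k<n) (fromℕ< 1+k<n)
    consecutive {k} k<n 1+k<n rewrite toℕ-fromℕ< k<n | toℕ-fromℕ< 1+k<n | +-comm k 1 = m<n⇒m%n≡m 1+k<n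

    CycEdge-sym : ∀ {u v} → CycEdge n H u v → CycEdge n H v u
    CycEdge-sym (i , j , c , inj₁ e) = i , j , c , inj₂ e
    CycEdge-sym (i , j , c , inj₂ e) = i , j , c , inj₁ e

    cyc-step : ∀ k → suc k < n → CycEdge n H (x k) (x (suc k))
    cyc-step k 1+k<n = let k<n = <-trans (n<1+n k) 1+k<n in
      fromℕ< k<n , fromℕ< 1+k<n , consecutive k<n 1+k<n , inj₁ (H-fromℕ< k<n , H-fromℕ< 1+k<n)

    0<n : 0 < n
    0<n = subst (0 <_) period≡n (<-trans z<s 2<period)

    last<n : last < n
    last<n = subst (last <_) period≡n last<period

    cyc-last : CycEdge n H (x last) (x 0)
    cyc-last = fromℕ< last<n , fromℕ< 0<n , wrap , inj₁ (H-fromℕ< last<n , H-fromℕ< 0<n)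
      where
      wrap : Consec n (fromℕ< last<n) (fromℕ< 0<n)
      wrap rewrite toℕ-fromℕ< last<n | toℕ-fromℕ< 0<n | +-comm last 1 =
        trans (cong (_% n) (trans suc-last period≡n)) (n%n≡0 n)

    cyc-next : ∀ k → k < n → CycEdge n H (x k) (x (suc k))
    cyc-next k k<n with suc k <? n
    ... | yes 1+k<n = cyc-step k 1+k<n
    ... | no  1+k≮n = subst (λ m → CycEdge n H (x m) (x (suc m))) (sym k≡last)
        (subst (CycEdge n H (x last)) (trans x-period (cong x (sym suc-last))) cyc-last)
      where
      k≡last : k ≡ last
      k≡last = suc-injective (trans (≤-antisym k<n (≮⇒≥ 1+k≮n)) (sym (trans suc-last period≡n)))

    cyc-covers : ∀ {u v} → E u v → CycEdge n H u v
    cyc-covers {u} e with all-visited u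
    cyc-covers (inj₁ refl) | zero , _ , refl = cyc-step 0 (subst (1 <_) period≡n (<-trans (n<1+n 1) 2<period))
    cyc-covers (inj₂ refl) | zero , _ , refl = subst (CycEdge n H (x 0)) x-last (CycEdge-sym cyc-last)
    cyc-covers e | suc k , k< , refl with x-only k e
    ... | inj₁ refl = CycEdge-sym (cyc-step k (subst (suc k <_) period≡n k<))
    ... | inj₂ refl = cyc-next (suc k) (subst (suc k <_) period≡n k<)

    cyc-edge : ∀ i j → Consec n i j → E (H i) (H j)
    cyc-edge i j c with suc (toℕ i) <? n
    ... | yes 1+i<n = subst (E (H i)) (cong x (trans (sym (m<n⇒m%n≡m 1+i<n)) (trans (cong (_% n) (+-comm 1 (toℕ i))) c))) (x-edge (toℕ i))
    ... | no  1+i≮n = subst (E (H i)) (trans (cong x 1+i≡period) (trans (sym x-period) (cong x 0≡j))) (x-edge (toℕ i))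
      where
      1+i≡n : suc (toℕ i) ≡ n
      1+i≡n = ≤-antisym (toℕ<n i) (≮⇒≥ 1+i≮n)
      1+i≡period : suc (toℕ i) ≡ period
      1+i≡period = trans 1+i≡n (sym period≡n)
      0≡j : 0 ≡ toℕ j
      0≡j = trans (sym (n%n≡0 n)) (trans (cong (_% n) (trans (sym 1+i≡n) (+-comm 1 (toℕ i)))) c)

  hamiltonCycle : HamiltonCycle n E
  hamiltonCycle = record
    { cycle          = H
    ; injective      = λ {i} {j} eq → toℕ-injective
        (x-injective (subst (toℕ i <_) (sym period≡n) (toℕ<n i)) (subst (toℕ j <_) (sym period≡n) (toℕ<n j)) eq)
    ; edge           = cyc-edge
    ; covers         = cyc-covers
    ; position       = λ v → fromℕ< (index<n v)
    ; cycle-position = λ v → trans (H-fromℕ< (index<n v)) (proj₂ (proj₂ (all-visited v)))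
    }
    where
    index<n : ∀ v → proj₁ (all-visited v) < n
    index<n v = subst (proj₁ (all-visited v) <_) period≡n (proj₁ (proj₂ (all-visited v)))

-- As n is even, the parity of the position along the cycle decides the parity of distances.
module PositionParity {n : ℕ} .{{_ : NonZero n}} {E : Fin n → Fin n → Set} (n-even : parity n ≡ 0ℙ)
  (h : HamiltonCycle n E) where

  open HamiltonCycle h

  abstract
    colour : Fin n → Parity
    colour v = parity (toℕ (position v))

  private
    parity-∣-∣ : ∀ i j → parity ∣ i - j ∣ ≡ parity i ⊞ parity j
    parity-∣-∣ zero zero = refl
    parity-∣-∣ zero (suc j) = refl
    parity-∣-∣ (suc i) zero = sym (ℙ.+-identityʳ _)
    parity-∣-∣ (suc i) (suc j) = trans (parity-∣-∣ i j)
      (trans (cancel (parity i) (parity j)) (cong₂ _⊞_ (sym (parity-suc i)) (sym (parity-suc j))))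
      where
      cancel : ∀ p q → p ⊞ q ≡ (p ⁻¹) ⊞ (q ⁻¹)
      cancel 0ℙ 0ℙ = refl
      cancel 0ℙ 1ℙ = refl
      cancel 1ℙ 0ℙ = refl
      cancel 1ℙ 1ℙ = refl

    parity-∸ : ∀ d → d ≤ n → parity (n ∸ d) ≡ parity d
    parity-∸ d d≤n = ≡-of-sum (parity (n ∸ d)) (parity d)
      (trans (sym (+-homo-+ (n ∸ d) d)) (trans (cong parity (m∸n+n≡m d≤n)) n-even))
      where
      ≡-of-sum : ∀ p q → p ⊞ q ≡ 0ℙ → p ≡ q
      ≡-of-sum 0ℙ 0ℙ _ = refl
      ≡-of-sum 1ℙ 1ℙ _ = refl

    parity-cycDist : ∀ (i j : Fin n) → parity (cycDist n i j) ≡ parity (toℕ i) ⊞ parity (toℕ j)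
    parity-cycDist i j with ⊓-sel ∣ toℕ i - toℕ j ∣ (n ∸ ∣ toℕ i - toℕ j ∣)
    ... | inj₁ e = trans (cong parity e) (parity-∣-∣ (toℕ i) (toℕ j))
    ... | inj₂ e = trans (cong parity e) (trans
      (parity-∸ _ (≤-trans (∣m-n∣≤m⊔n (toℕ i) (toℕ j)) (⊔-lub (<⇒≤ (toℕ<n i)) (<⇒≤ (toℕ<n j)))))
      (parity-∣-∣ (toℕ i) (toℕ j)))

    consec-flips : ∀ (i j : Fin n) → Consec n i j → parity (toℕ j) ≡ parity (toℕ i) ⁻¹
    consec-flips i j c = begin
      parity (toℕ j)             ≡⟨ cong parity (sym c) ⟩
      parity ((toℕ i + 1) % n)   ≡⟨ ≈-parity n-even (%-≈ n (toℕ i + 1)) ⟩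
      parity (toℕ i + 1)         ≡⟨ cong parity (+-comm (toℕ i) 1) ⟩
      parity (suc (toℕ i))       ≡⟨ parity-suc (toℕ i) ⟩
      parity (toℕ i) ⁻¹          ∎
      where open ≡-Reasoning

  abstract
    colour-cycle : ∀ i → colour (cycle i) ≡ parity (toℕ i)
    colour-cycle i = cong (parity ∘ toℕ) (injective (cycle-position (cycle i)))

    cycEdge-flips : ∀ {u v} → CycEdge n cycle u v → colour v ≡ colour u ⁻¹
    cycEdge-flips (i , j , c , inj₁ (refl , refl)) =
      trans (colour-cycle j) (trans (consec-flips i j c) (cong _⁻¹ (sym (colour-cycle i))))
    cycEdge-flips (i , j , c , inj₂ (refl , refl)) =
      trans (colour-cycle i) (trans (sym (⁻¹-involutive _)) (cong _⁻¹ (trans (sym (consec-flips i j c)) (sym (colour-cycle j)))))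

    edge-flips : ∀ {u v} → E u v → colour v ≡ colour u ⁻¹
    edge-flips e = cycEdge-flips (covers e)

    oddDist : ∀ {u v} → colour v ≡ colour u ⁻¹ → OddDistAlong n cycle u v
    oddDist {u} {v} e = position u , position v , cycle-position u , cycle-position v ,
      odd⇒%2≡1 (cycDist n (position u) (position v)) (trans (parity-cycDist (position u) (position v)) (trans (cong (colour u ⊞_) e) (ℙ.p+p⁻¹≡1ℙ (colour u))))

-- Residues modulo n and cosets of cyclic subgroups

x+yz≡y+xz : ∀ x y z → x + (y + z) ≡ y + (x + z)
x+yz≡y+xz = solve-∀

x*yz≡y*xz : ∀ x y z → x * (y * z) ≡ y * (x * z)
x*yz≡y*xz = solve-∀

x*y*z≡y*xz : ∀ x y z → x * y * z ≡ y * (x * z)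
x*y*z≡y*xz = solve-∀

inverse : ∀ {h N} .{{_ : NonZero N}} → Coprime h N → ∃ λ h̄ → (h * h̄) ≈ 1 mod N
inverse {h} {N} coprime with coprime-Bézout coprime
... | Bézout.+- x y eq = x , cong-by 0 y (trans (+-identityʳ _) (trans (*-comm h x) (sym eq)))
-- Here `x * h` is -1 modulo `N`; the factor `pred N` corrects the sign.
... | Bézout.-+ x y eq = pred N * x , cong-by y (h * x) (begin
    h * (pred N * x) + y * N         ≡⟨ cong (h * (pred N * x) +_) (sym eq) ⟩
    h * (pred N * x) + (1 + x * h)   ≡⟨ shuffle h (pred N) x ⟩
    1 + h * x * suc (pred N)         ≡⟨ cong (λ z → 1 + h * x * z) (suc-pred N) ⟩
    1 + h * x * N                    ∎)
  where
  open ≡-Reasoning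
  shuffle : ∀ h m x → h * (m * x) + (1 + x * h) ≡ 1 + h * x * suc m
  shuffle = solve-∀

module Residues (n : ℕ) .{{_ : NonZero n}} where

  V : Set
  V = Fin n

  infixl 6 _⊕_ _⊖_

  abstract
    π : ℕ → V
    π x = x mod n

    toℕ-π : ∀ x → toℕ (π x) ≡ x % n
    toℕ-π x = toℕ-fromℕ< (m%n<n x n)

  _⊕_ : V → ℕ → V
  v ⊕ k = π (toℕ v + k)

  -- The subtrahend is negated by multiplying it with n − 1.
  _⊖_ : V → ℕ → V
  v ⊖ k = v ⊕ pred n * k

  π-cong : ∀ {x y} → x ≈ y mod n → π x ≡ π y
  π-cong {x} {y} x≈y = toℕ-injective (trans (toℕ-π x) (trans (≈⇒%≡ n x≈y) (sym (toℕ-π y))))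

  π-injective : ∀ {x y} → π x ≡ π y → x ≈ y mod n
  π-injective {x} {y} eq = %≡⇒≈ n (trans (sym (toℕ-π x)) (trans (cong toℕ eq) (toℕ-π y)))

  π-toℕ : ∀ v → π (toℕ v) ≡ v
  π-toℕ v = toℕ-injective (trans (toℕ-π (toℕ v)) (m<n⇒m%n≡m (toℕ<n v)))

  toℕ-π-≈ : ∀ x → toℕ (π x) ≈ x mod n
  toℕ-π-≈ x = ≈-trans (≈-reflexive (toℕ-π x)) (%-≈ n x)

  π-⊕ : ∀ x k → π x ⊕ k ≡ π (x + k)
  π-⊕ x k = π-cong (≈-+ (toℕ-π-≈ x) ≈-refl)

  ⊕-⊕ : ∀ v k l → v ⊕ k ⊕ l ≡ v ⊕ (k + l)
  ⊕-⊕ v k l = trans (π-⊕ (toℕ v + k) l) (cong π (+-assoc (toℕ v) k l))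

  ⊕-comm : ∀ v k l → v ⊕ k ⊕ l ≡ v ⊕ l ⊕ k
  ⊕-comm v k l = trans (⊕-⊕ v k l) (trans (cong (v ⊕_) (+-comm k l)) (sym (⊕-⊕ v l k)))

  ⊕-zero : ∀ v → v ⊕ 0 ≡ v
  ⊕-zero v = trans (cong π (+-identityʳ (toℕ v))) (π-toℕ v)

  ⊕-cong : ∀ v {k l} → k ≈ l mod n → v ⊕ k ≡ v ⊕ l
  ⊕-cong v k≈l = π-cong (≈-+ {x = toℕ v} ≈-refl k≈l)

  ⊕-cancelˡ : ∀ v {k l} → v ⊕ k ≡ v ⊕ l → k ≈ l mod n
  ⊕-cancelˡ v {k} {l} eq = ≈-cancel (toℕ v) (toℕ v)
    (≈-trans (≈-reflexive (+-comm k (toℕ v))) (≈-trans (π-injective eq) (≈-reflexive (+-comm (toℕ v) l)))) ≈-refl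

  k+[n-1]k≈0 : ∀ k → (k + pred n * k) ≈ 0 mod n
  k+[n-1]k≈0 k = cong-by 0 k (trans (+-identityʳ _) (trans (cong (_* k) (suc-pred n)) (*-comm n k)))

  ⊕-⊖ : ∀ v k → v ⊕ k ⊖ k ≡ v
  ⊕-⊖ v k = trans (⊕-⊕ v k _) (trans (⊕-cong v (k+[n-1]k≈0 k)) (⊕-zero v))

  ⊖-⊕ : ∀ v k → v ⊖ k ⊕ k ≡ v
  ⊖-⊕ v k = trans (⊕-comm v _ k) (⊕-⊖ v k)

  ⊕-cancelʳ : ∀ {u v} k → u ⊕ k ≡ v ⊕ k → u ≡ v
  ⊕-cancelʳ {u} {v} k eq = trans (sym (⊕-⊖ u k)) (trans (cong (_⊖ k) eq) (⊕-⊖ v k))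

  -- The coset of v modulo ⟨g⟩ is labelled by kind v < N, and h moves to the next coset.
  record Cosets (g h N : ℕ) : Set where
    field
      kind     : V → ℕ
      kind<    : ∀ v → kind v < N
      kind-g   : ∀ v → kind (v ⊕ g) ≡ kind v
      kind-π   : ∀ i j → i < N → kind (π (i * h + j * g)) ≡ i
      kind-π-N : ∀ j → kind (π (N * h + j * g)) ≡ 0
      reach    : ∀ u w → kind u ≡ kind w → ∃ λ m → w ≡ u ⊕ m * g
      order    : ℕ
      order*N≡n : order * N ≡ n
      order*g≈0 : (order * g) ≈ 0 mod n
      order∣    : ∀ {k} → (k * g) ≈ 0 mod n → order ∣ k

  -- Hence ⟨g⟩ is generated by `gcd g n`, and its cosets are the residue classes modulo `gcd g n`.
  gcd-multiple : ∀ g → ∃ λ m → gcd g n ≈ (m * g) mod n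
  gcd-multiple g = from-identity (Bézout.identity (gcd-GCD g n))
    where
    open ≡-Reasoning
    shuffle : ∀ N x g m → N + x * g * suc m ≡ m * x * g + (N + x * g)
    shuffle = solve-∀

    from-identity : ∀ {N} → Bézout.Identity N g n → ∃ λ m → N ≈ (m * g) mod n
    from-identity (Bézout.+- x y eq) = x , cong-by y 0 (trans eq (sym (+-identityʳ _)))
    from-identity {N} (Bézout.-+ x y eq) = pred n * x , cong-by (x * g) y (begin
      N + x * g * n                  ≡⟨ cong (λ z → N + x * g * z) (sym (suc-pred n)) ⟩
      N + x * g * suc (pred n)       ≡⟨ shuffle N x g (pred n) ⟩
      pred n * x * g + (N + x * g)   ≡⟨ cong (pred n * x * g +_) eq ⟩
      pred n * x * g + y * n         ∎)

  module _ (g h h̄ N : ℕ) .{{_ : NonZero N}} (N∣g : N ∣ g) (N∣n : N ∣ n)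
    (multiple : ∃ λ m → N ≈ (m * g) mod n) (hh̄≈1 : (h * h̄) ≈ 1 mod N) where

    private
      -- The coset of `i * h` is the class of `i * h` modulo `N`; multiplication by the inverse of
      -- `h` recovers `i`.
      label : V → ℕ
      label v = (toℕ v * h̄) % N

      drop-g : ∀ x j → (x + j * g) ≈ x mod N
      drop-g x j = ≈-trans (≈-+ {x = x} ≈-refl (∣⇒≈0 (∣n⇒∣m*n j N∣g))) (≈-reflexive (+-identityʳ x))

      label-g : ∀ v → label (v ⊕ g) ≡ label v
      label-g v = ≈⇒%≡ N (≈-* h̄ (≈-trans (≈-∣ N∣n (toℕ-π-≈ (toℕ v + g)))
        (≈-trans (≈-reflexive (cong (toℕ v +_) (sym (*-identityˡ g)))) (drop-g (toℕ v) 1))))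

      label-π : ∀ i j → label (π (i * h + j * g)) ≡ i % N
      label-π i j = ≈⇒%≡ N (≈-trans (≈-* h̄ (≈-trans (≈-∣ N∣n (toℕ-π-≈ (i * h + j * g))) (drop-g (i * h) j)))
        (≈-trans (≈-reflexive (*-assoc i h h̄)) (≈-trans (≈-*ˡ i hh̄≈1) (≈-reflexive (*-identityʳ i)))))

      undo : ∀ x → (h * (x * h̄)) ≈ x mod N
      undo x = ≈-trans (≈-reflexive (x*yz≡y*xz h x h̄)) (≈-trans (≈-*ˡ x hh̄≈1) (≈-reflexive (*-identityʳ x)))

      label≡⇒≈ : ∀ {u w} → label u ≡ label w → toℕ u ≈ toℕ w mod N
      label≡⇒≈ {u} {w} eq = ≈-trans (≈-sym (undo (toℕ u))) (≈-trans (≈-*ˡ h (%≡⇒≈ N eq)) (undo (toℕ w)))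

      difference : V → V → ℕ
      difference u w = toℕ w + pred n * toℕ u

      ⊕-difference : ∀ u w → u ⊕ difference u w ≡ w
      ⊕-difference u w = trans (π-cong (≈-trans (≈-reflexive (x+yz≡y+xz (toℕ u) (toℕ w) (pred n * toℕ u)))
        (≈-trans (≈-+ {x = toℕ w} ≈-refl (k+[n-1]k≈0 (toℕ u))) (≈-reflexive (+-identityʳ (toℕ w)))))) (π-toℕ w)

      N∣difference : ∀ u w → label u ≡ label w → N ∣ difference u w
      N∣difference u w eq = ≈0⇒∣ (≈-trans (≈-+ (≈-sym (label≡⇒≈ {u} {w} eq)) (≈-refl {x = pred n * toℕ u}))
        (≈-∣ N∣n (k+[n-1]k≈0 (toℕ u))))

      c*N≈ : ∀ c → (c * N) ≈ (c * proj₁ multiple * g) mod n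
      c*N≈ c = ≈-trans (≈-*ˡ c (proj₂ multiple)) (≈-reflexive (sym (*-assoc c (proj₁ multiple) g)))

      reaches : ∀ u w → label u ≡ label w → ∃ λ m → w ≡ u ⊕ m * g
      reaches u w eq = let divides c c-eq = N∣difference u w eq in
        c * proj₁ multiple ,
        trans (sym (⊕-difference u w)) (trans (cong (u ⊕_) c-eq) (⊕-cong u {c * N} (c*N≈ c)))

      quotient : ℕ
      quotient = _∣_.quotient N∣n

      n≡ : n ≡ quotient * N
      n≡ = _∣_.equality N∣n

      quotient*g≈0 : (quotient * g) ≈ 0 mod n
      quotient*g≈0 = let divides g′ g≡ = N∣g in ∣⇒≈0 (divides g′ (begin
        quotient * g          ≡⟨ cong (quotient *_) g≡ ⟩
        quotient * (g′ * N)   ≡⟨ x*yz≡y*xz quotient g′ N ⟩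
        g′ * (quotient * N)   ≡⟨ cong (g′ *_) (sym n≡) ⟩
        g′ * n                ∎))
        where open ≡-Reasoning

      -- As `N` is a multiple of `g` modulo `n`, also `k * N` vanishes modulo `n = quotient * N`.
      quotient∣ : ∀ {k} → (k * g) ≈ 0 mod n → quotient ∣ k
      quotient∣ {k} kg≈0 = *-cancelʳ-∣ N (subst (_∣ k * N) n≡ (≈0⇒∣ (≈-trans (c*N≈ k)
        (≈-trans (≈-reflexive (x*y*z≡y*xz k (proj₁ multiple) g))
          (≈-trans (≈-*ˡ (proj₁ multiple) kg≈0) (≈-reflexive (*-zeroʳ (proj₁ multiple))))))))

    cosets : Cosets g h N
    cosets = record
      { kind     = label
      ; kind<    = λ v → m%n<n (toℕ v * h̄) N
      ; kind-g   = label-g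
      ; kind-π   = λ i j i<N → trans (label-π i j) (m<n⇒m%n≡m i<N)
      ; kind-π-N = λ j → trans (label-π N j) (n%n≡0 N)
      ; reach    = reaches
      ; order    = quotient
      ; order*N≡n = sym n≡
      ; order*g≈0 = quotient*g≈0
      ; order∣    = quotient∣
      }

  -- Two-valued functions along the cosets of a single step

  module Orbits {g h N : ℕ} (K : Cosets g h N) where
    open Cosets K

    kind-m*g : ∀ v m → kind (v ⊕ m * g) ≡ kind v
    kind-m*g v zero    = cong kind (⊕-zero v)
    kind-m*g v (suc m) = trans (cong kind (sym (⊕-⊕ v g (m * g)))) (trans (kind-m*g (v ⊕ g) m) (kind-g v))

    ⊕-suc : ∀ v m → v ⊕ m * g ⊕ g ≡ v ⊕ suc m * g
    ⊕-suc v m = trans (⊕-⊕ v (m * g) g) (cong (v ⊕_) (+-comm (m * g) g))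

    walk : ∀ (f : V → Parity) u m → (∀ k → k < m → f (u ⊕ k * g ⊕ g) ≡ f (u ⊕ k * g)) → f (u ⊕ m * g) ≡ f u
    walk f u zero    _  = cong f (⊕-zero u)
    walk f u (suc m) ok = trans (cong f (sym (⊕-suc u m)))
      (trans (ok m (n<1+n m)) (walk f u m (λ k k<m → ok k (m<n⇒m<1+n k<m))))

    -- A shortest path from u to w passes neither through w nor through u − g.
    arc : ∀ (f : V → Parity) u w → kind u ≡ kind w →
      (∀ v → kind v ≡ kind u → v ≢ w → v ⊕ g ≢ u → f (v ⊕ g) ≡ f v) → f u ≡ f w
    arc f u w same ok with least (λ m → w ≟ u ⊕ m * g) {proj₁ (reach u w same)} (proj₂ (reach u w same))
    ... | m , w≡ , shortest = trans (sym (walk f u m λ k k<m →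
        ok (u ⊕ k * g) (kind-m*g u k) (λ eq → shortest k<m (sym eq)) (detour k k<m))) (cong f (sym w≡))
      where
      detour : ∀ k → k < m → u ⊕ k * g ⊕ g ≢ u
      detour k k<m eq = shortest (subst (m ∸ suc k <_) rest (s≤s (m≤n+m (m ∸ suc k) k)))
        (trans w≡ (begin
          u ⊕ m * g                              ≡⟨ cong (λ z → u ⊕ z * g) (sym (m+[n∸m]≡n k<m)) ⟩
          u ⊕ (suc k + (m ∸ suc k)) * g          ≡⟨ cong (u ⊕_) (*-distribʳ-+ g (suc k) (m ∸ suc k)) ⟩
          u ⊕ (suc k * g + (m ∸ suc k) * g)      ≡⟨ sym (⊕-⊕ u (suc k * g) _) ⟩
          u ⊕ suc k * g ⊕ (m ∸ suc k) * g        ≡⟨ cong (_⊕ (m ∸ suc k) * g) (trans (sym (⊕-suc u k)) eq) ⟩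
          u ⊕ (m ∸ suc k) * g                    ∎))
        where
        open ≡-Reasoning
        rest : suc (k + (m ∸ suc k)) ≡ m
        rest = m+[n∸m]≡n k<m

    walk-flip : ∀ (f : V → Parity) u m → (∀ k → k < m → f (u ⊕ k * g ⊕ g) ≡ f (u ⊕ k * g) ⁻¹) →
      f (u ⊕ m * g) ≡ parity m ⊞ f u
    walk-flip f u zero    _  = cong f (⊕-zero u)
    walk-flip f u (suc m) ok = begin
      f (u ⊕ suc m * g)       ≡⟨ cong f (sym (⊕-suc u m)) ⟩
      f (u ⊕ m * g ⊕ g)       ≡⟨ ok m (n<1+n m) ⟩
      f (u ⊕ m * g) ⁻¹        ≡⟨ cong _⁻¹ (walk-flip f u m (λ k k<m → ok k (m<n⇒m<1+n k<m))) ⟩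
      (parity m ⊞ f u) ⁻¹     ≡⟨ sym (⁻¹-⊞ (parity m) (f u)) ⟩
      (parity m ⁻¹) ⊞ f u     ≡⟨ cong (_⊞ f u) (sym (parity-suc m)) ⟩
      parity (suc m) ⊞ f u    ∎
      where
      open ≡-Reasoning
      ⁻¹-⊞ : ∀ p q → (p ⁻¹) ⊞ q ≡ (p ⊞ q) ⁻¹
      ⁻¹-⊞ 0ℙ q = refl
      ⁻¹-⊞ 1ℙ q = sym (⁻¹-involutive q)

    order≢0 : order ≢ 0
    order≢0 order≡0 = ≢-nonZero⁻¹ n (trans (sym order*N≡n) (cong (_* N) order≡0))

    -- Walking from x + g around the coset to x takes order − 1 steps.
    one-exception : ∀ (f : V → Parity) x → (∀ v → kind v ≡ kind x → v ≢ x → f (v ⊕ g) ≡ f v ⁻¹) →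
      f (x ⊕ g) ≡ parity (suc order) ⊞ f x
    one-exception f x ok = solve-for (parity (suc order)) (begin
      f x                                  ≡⟨ cong f (sym (trans (⊕-cong x order*g≈0) (⊕-zero x))) ⟩
      f (x ⊕ order * g)                    ≡⟨ cong (λ z → f (x ⊕ z * g)) (sym suc-order-1) ⟩
      f (x ⊕ suc (pred order) * g)         ≡⟨ cong f (sym (⊕-⊕ x g _)) ⟩
      f (x ⊕ g ⊕ pred order * g)           ≡⟨ walk-flip f (x ⊕ g) (pred order) (λ k k< → ok _
                                                (trans (kind-m*g (x ⊕ g) k) (kind-g x)) (not-back k k<)) ⟩
      parity (pred order) ⊞ f (x ⊕ g)      ≡⟨ cong (λ z → parity (suc z) ⊞ f (x ⊕ g)) suc-order-1 ⟩
      parity (suc order) ⊞ f (x ⊕ g)       ∎)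
      where
      open ≡-Reasoning
      suc-order-1 : suc (pred order) ≡ order
      suc-order-1 = suc-pred order {{≢-nonZero order≢0}}
      solve-for : ∀ {p r} q → p ≡ q ⊞ r → r ≡ q ⊞ p
      solve-for 0ℙ eq   = sym eq
      solve-for 1ℙ refl = sym (⁻¹-involutive _)
      not-back : ∀ k → k < pred order → x ⊕ g ⊕ k * g ≢ x
      not-back k k< eq = <-irrefl refl (<-≤-trans (subst (suc k <_) suc-order-1 (s<s k<))
        (∣⇒≤ (order∣ (⊕-cancelˡ x (trans (sym (⊕-⊕ x g (k * g))) (trans eq (sym (⊕-zero x))))))))

    even-order-exception : parity order ≡ 0ℙ → ∀ (f : V → Parity) x →
      (∀ v → kind v ≡ kind x → v ≢ x → f (v ⊕ g) ≡ f v ⁻¹) → f (x ⊕ g) ≡ f x ⁻¹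
    even-order-exception even f x ok = trans (one-exception f x ok)
      (cong (_⊞ f x) (trans (parity-suc order) (cong _⁻¹ even)))

    odd-order-exception : parity order ≡ 1ℙ → ∀ (f : V → Parity) x →
      (∀ v → kind v ≡ kind x → v ≢ x → f (v ⊕ g) ≡ f v ⁻¹) → f (x ⊕ g) ≡ f x
    odd-order-exception odd f x ok = trans (one-exception f x ok)
      (cong (_⊞ f x) (trans (parity-suc order) (cong _⁻¹ odd)))

    flips⇒even-order : ∀ (f : V → Parity) x → (∀ v → kind v ≡ kind x → f (v ⊕ g) ≡ f v ⁻¹) → parity order ≡ 0ℙ
    flips⇒even-order f x ok with parity order in eq
    ... | 0ℙ = refl
    ... | 1ℙ = contradiction (trans (sym (odd-order-exception eq f x (λ v k _ → ok v k))) (ok x refl)) (p≢p⁻¹ (f x))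

    -- The squares form a staircase: y i lies in the coset of x (i + 1). The last y opens a new
    -- coset, or returns to the coset of x 0 after an odd number of squares.
    module Staircase (f : V → Parity) (x y : ℕ → V) (D : ℕ)
      (inv : ∀ v → (∀ i → i ≤ D → v ≢ x i × v ≢ y i) → f (v ⊕ g) ≡ f v)
      (low : ∀ i → i ≤ D → f (x i) ≡ f (y i)) (high : ∀ i → i ≤ D → f (x i ⊕ g) ≡ f (y i ⊕ g))
      (kind-x : ∀ i → i ≤ D → kind (x i) ≡ i) (kind-y : ∀ i → i < D → kind (y i) ≡ suc i)
      (end : (kind (y D) ≡ suc D × N ≡ 2 + D) ⊎ (kind (y D) ≡ 0 × N ≡ suc D × parity D ≡ 0ℙ))
      where

      private
        kind-y′ : ∀ i → i ≤ D → (kind (y i) ≡ suc i) ⊎ (i ≡ D × kind (y i) ≡ 0)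
        kind-y′ i i≤D with i ≟ᴺ D
        ... | no i≢D = inj₁ (kind-y i (≤∧≢⇒< i≤D i≢D))
        ... | yes refl = [ (λ e → inj₁ (proj₁ e)) , (λ e → inj₂ (refl , proj₁ e)) ]′ end

        inv-suc : ∀ k v → suc k ≤ D → kind v ≡ suc k → v ≢ x (suc k) → v ≢ y k → f (v ⊕ g) ≡ f v
        inv-suc k v k<D kv v≢x v≢y = inv v λ i i≤D →
          (λ { refl → v≢x (cong x (trans (sym (kind-x i i≤D)) kv)) }) ,
          (λ { refl → case kind-y′ i i≤D of λ
               { (inj₁ ki) → v≢y (cong y (suc-injective (trans (sym ki) kv)))
               ; (inj₂ (_ , ki)) → 0≢1+n (trans (sym ki) kv) } })

        -- The broken edges after `x (suc k)` and `y k` cut their coset into two arcs, each running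
        -- from just after one break to the other; `arc-down` and `arc-up` follow one arc each.
        arc-down : ∀ k → suc k ≤ D → f (x (suc k) ⊕ g) ≡ f (y k)
        arc-down k k<D = arc f _ _ (trans kx (sym (kind-y k k<D))) λ v kv v≢y v+g≢ →
          inv-suc k v k<D (trans kv kx) (λ { refl → v+g≢ refl }) v≢y
          where
          kx : kind (x (suc k) ⊕ g) ≡ suc k
          kx = trans (kind-g _) (kind-x (suc k) k<D)

        arc-up : ∀ k → suc k ≤ D → f (y k ⊕ g) ≡ f (x (suc k))
        arc-up k k<D = arc f _ _ (trans ky (sym (kind-x (suc k) k<D))) λ v kv v≢x v+g≢ →
          inv-suc k v k<D (trans kv ky) v≢x (λ { refl → v+g≢ refl })
          where
          ky : kind (y k ⊕ g) ≡ suc k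
          ky = trans (kind-g _) (kind-y k k<D)

        -- The arcs exchange the near and the far ends of the broken edges, so a strand is back on
        -- its own side only after two squares. The parity condition in `end` comes from here.
        two-steps : ∀ k → 2 + k ≤ D → f (x (2 + k)) ≡ f (x k)
        two-steps k 2+k≤D = begin
          f (x (2 + k))       ≡⟨ sym (arc-up (suc k) 2+k≤D) ⟩
          f (y (suc k) ⊕ g)   ≡⟨ sym (high (suc k) k<D) ⟩
          f (x (suc k) ⊕ g)   ≡⟨ arc-down k k<D ⟩
          f (y k)             ≡⟨ sym (low k (<⇒≤ k<D)) ⟩
          f (x k)             ∎
          where
          open ≡-Reasoning
          k<D : suc k ≤ D
          k<D = <⇒≤ 2+k≤D

        even-steps : ∀ k → k ≤ D → parity k ≡ 0ℙ → f (x k) ≡ f (x 0)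
        even-steps zero          _   _ = refl
        even-steps (suc (suc k)) k≤D e = trans (two-steps k k≤D) (even-steps k (≤-trans (m≤n+m k 2) k≤D) e)

        kx0 : kind (x 0 ⊕ g) ≡ 0
        kx0 = trans (kind-g _) (kind-x 0 z≤n)

        -- If the staircase ends in a new coset, coset 0 has one break only and going around it
        -- joins the two ends. If it closes up, going around leads to `y D`, and the even number `D`
        -- of steps leads back to `x 0`.
        start : f (x 0 ⊕ g) ≡ f (x 0)
        start = case end of λ
          { (inj₁ (kyD , _)) → arc f _ _ (trans kx0 (sym (kind-x 0 z≤n))) λ v kv v≢x _ →
              inv v λ i i≤D → (λ { refl → v≢x (cong x (trans (sym (kind-x i i≤D)) (trans kv kx0))) }) ,
                (λ { refl → case kind-y′ i i≤D of λ
                  { (inj₁ ki) → 1+n≢0 (trans (sym ki) (trans kv kx0))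
                  ; (inj₂ (refl , ki)) → 1+n≢0 (trans (sym kyD) ki) } })
          ; (inj₂ (kyD , _ , even)) → trans (arc f _ _ (trans kx0 (sym kyD)) λ v kv v≢y v+g≢ →
              inv v λ i i≤D → (λ { refl → v+g≢ (cong (λ z → x z ⊕ g) (trans (sym (kind-x i i≤D)) (trans kv kx0))) }) ,
                (λ { refl → case kind-y′ i i≤D of λ
                  { (inj₁ ki) → 1+n≢0 (trans (sym ki) (trans kv kx0))
                  ; (inj₂ (refl , _)) → v≢y refl } }))
              (trans (sym (low D ≤-refl)) (even-steps D ≤-refl even)) }

        -- Once the ends of the first broken edge agree, the agreement climbs: the square carries it
        -- from `x k` to `y k`, and then `x (suc k)` is the only break left in its coset.
        straight-x : ∀ k → k ≤ D → f (x k ⊕ g) ≡ f (x k)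
        straight-y : ∀ k → k ≤ D → f (y k ⊕ g) ≡ f (y k)
        straight-y k k≤D = trans (sym (high k k≤D)) (trans (straight-x k k≤D) (low k k≤D))
        straight-x zero    _   = start
        straight-x (suc k) k<D = arc f _ _ (kind-g _) λ v kv v≢x _ →
          case v ≟ y k of λ
            { (yes refl) → straight-y k (<⇒≤ k<D)
            ; (no v≢y)   → inv-suc k v k<D (trans kv (trans (kind-g _) (kind-x (suc k) k<D))) v≢x v≢y }

        straight : ∀ v → f (v ⊕ g) ≡ f v
        straight v with anyUpTo? (λ i → (v ≟ x i) ⊎-dec (v ≟ y i)) (suc D)
        ... | yes (i , s≤s i≤D , inj₁ refl) = straight-x i i≤D
        ... | yes (i , s≤s i≤D , inj₂ refl) = straight-y i i≤D
        ... | no none = inv v λ i i≤D → (λ e → none (i , s≤s i≤D , inj₁ e)) , (λ e → none (i , s≤s i≤D , inj₂ e))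

        same-kind : ∀ u v → kind u ≡ kind v → f u ≡ f v
        same-kind u v eq = arc f u v eq λ w _ _ _ → straight w

        all-x : ∀ k → k ≤ D → f (x k) ≡ f (x 0)
        all-x zero    _   = refl
        all-x (suc k) k<D = trans (same-kind _ _ (trans (kind-x (suc k) k<D) (sym (kind-y k k<D))))
          (trans (sym (low k (<⇒≤ k<D))) (all-x k (<⇒≤ k<D)))

        to-x0 : ∀ v → f v ≡ f (x 0)
        to-x0 v with kind v ≤? D
        ... | yes k≤D = trans (same-kind v (x (kind v)) (sym (kind-x _ k≤D))) (all-x _ k≤D)
        ... | no  k≰D = case end of λ
          { (inj₁ (kyD , N≡)) → trans (same-kind v (y D)
              (trans (≤-antisym (m<1+n⇒m≤n (subst (kind v <_) N≡ (kind< v))) (≰⇒> k≰D)) (sym kyD)))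
              (trans (sym (low D ≤-refl)) (all-x D ≤-refl))
          ; (inj₂ (_ , N≡ , _)) → contradiction (m<1+n⇒m≤n (subst (kind v <_) N≡ (kind< v))) k≰D }

      constant : ∀ u v → f u ≡ f v
      constant u v = trans (to-x0 u) (sym (to-x0 v))

-- Exchanging the two edge classes along squares

module Exchange (n : ℕ) .{{_ : NonZero n}} where
  open Residues n

  -- Together the fields say that 0, s, -s, t and -t are five distinct residues.
  record Generic (s t : ℕ) : Set where
    field
      s≉0   : ¬ s ≈ 0 mod n
      t≉0   : ¬ t ≈ 0 mod n
      2s≉0  : ¬ (s + s) ≈ 0 mod n
      2t≉0  : ¬ (t + t) ≈ 0 mod n
      s≉t   : ¬ s ≈ t mod n
      s+t≉0 : ¬ (s + t) ≈ 0 mod n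

  generic-swap : ∀ {s t} → Generic s t → Generic t s
  generic-swap {s} {t} gen = record
    { s≉0 = t≉0 ; t≉0 = s≉0 ; 2s≉0 = 2t≉0 ; 2t≉0 = 2s≉0
    ; s≉t = λ e → s≉t (≈-sym e) ; s+t≉0 = λ e → s+t≉0 (subst (_≈ 0 mod n) (+-comm t s) e) }
    where open Generic gen

  ⊕-≢ : ∀ v {k} → ¬ k ≈ 0 mod n → v ⊕ k ≢ v
  ⊕-≢ v k≉0 eq = k≉0 (⊕-cancelˡ v (trans eq (sym (⊕-zero v))))

  ⊖-≢ : ∀ v {k} → ¬ k ≈ 0 mod n → v ⊖ k ≢ v
  ⊖-≢ v {k} k≉0 eq = ⊕-≢ v k≉0 (trans (cong (_⊕ k) (sym eq)) (⊖-⊕ v k))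

  ⊕≢⊖ : ∀ v {k l} → ¬ (k + l) ≈ 0 mod n → v ⊕ k ≢ v ⊖ l
  ⊕≢⊖ v {k} {l} k+l≉0 eq = ⊕-≢ v k+l≉0 (trans (sym (⊕-⊕ v k l)) (trans (cong (_⊕ l) eq) (⊖-⊕ v l)))

  ⊕≢⊕ : ∀ v {k l} → ¬ k ≈ l mod n → v ⊕ k ≢ v ⊕ l
  ⊕≢⊕ v k≉l eq = k≉l (⊕-cancelˡ v eq)

  ⊖≢⊖ : ∀ v {k l} → ¬ k ≈ l mod n → v ⊖ k ≢ v ⊖ l
  ⊖≢⊖ v {k} {l} k≉l eq = ⊕≢⊕ v k≉l (sym (begin
    v ⊕ l             ≡⟨ cong (_⊕ l) (sym (⊖-⊕ v k)) ⟩
    v ⊖ k ⊕ k ⊕ l     ≡⟨ cong (λ z → z ⊕ k ⊕ l) eq ⟩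
    v ⊖ l ⊕ k ⊕ l     ≡⟨ ⊕-comm (v ⊖ l) k l ⟩
    v ⊖ l ⊕ l ⊕ k     ≡⟨ cong (_⊕ k) (⊖-⊕ v l) ⟩
    v ⊕ k             ∎))
    where open ≡-Reasoning

  ⊖-comm : ∀ v k l → v ⊖ k ⊖ l ≡ v ⊖ l ⊖ k
  ⊖-comm v k l = ⊕-comm v _ _

  InvariantsConstant : (V → V → Set) → Set
  InvariantsConstant E = ∀ (f : V → Parity) → (∀ {u v} → E u v → f v ≡ f u) → ∀ u v → f u ≡ f v

  module Corners (Q : V → Set) (Q? : ∀ v → Dec (Q v)) where

    -- Class (s , t) starts from the s-edges; at every square v, v + s, v + s + t, v + t with Q v
    -- its two s-edges are exchanged for the two t-edges.
    module Class (s t : ℕ) where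

      -- The substitute for the edge towards `v ⊕ s`: `v` is the lower left corner of a square, or
      -- its upper left corner, or neither. `Left` does the same for the edge towards `v ⊖ s`, with
      -- right corners.
      data Right (v : V) : V → Set where
        up   : Q v → Right v (v ⊕ t)
        down : ¬ Q v → Q (v ⊖ t) → Right v (v ⊖ t)
        flat : ¬ Q v → ¬ Q (v ⊖ t) → Right v (v ⊕ s)

      data Left (v : V) : V → Set where
        up   : Q (v ⊖ s) → Left v (v ⊕ t)
        down : ¬ Q (v ⊖ s) → Q (v ⊖ s ⊖ t) → Left v (v ⊖ t)
        flat : ¬ Q (v ⊖ s) → ¬ Q (v ⊖ s ⊖ t) → Left v (v ⊖ s)

      abstract
        right-view : ∀ v → ∃ (Right v)
        right-view v with Q? v | Q? (v ⊖ t)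
        ... | yes q | _      = _ , up q
        ... | no ¬q | yes q′ = _ , down ¬q q′
        ... | no ¬q | no ¬q′ = _ , flat ¬q ¬q′

        left-view : ∀ v → ∃ (Left v)
        left-view v with Q? (v ⊖ s) | Q? (v ⊖ s ⊖ t)
        ... | yes q | _      = _ , up q
        ... | no ¬q | yes q′ = _ , down ¬q q′
        ... | no ¬q | no ¬q′ = _ , flat ¬q ¬q′

      right left : V → V
      right v = proj₁ (right-view v)
      left v = proj₁ (left-view v)

      E : V → V → Set
      E u v = right u ≡ v ⊎ left u ≡ v

      right-unique : ∀ {v u} → Right v u → right v ≡ u
      right-unique {v} r with right-view v
      right-unique (up q)       | _ , up _       = refl
      right-unique (up q)       | _ , down ¬q _  = contradiction q ¬q
      right-unique (up q)       | _ , flat ¬q _  = contradiction q ¬q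
      right-unique (down ¬q _)  | _ , up q       = contradiction q ¬q
      right-unique (down _ _)   | _ , down _ _   = refl
      right-unique (down _ q)   | _ , flat _ ¬q  = contradiction q ¬q
      right-unique (flat ¬q _)  | _ , up q       = contradiction q ¬q
      right-unique (flat _ ¬q)  | _ , down _ q   = contradiction q ¬q
      right-unique (flat _ _)   | _ , flat _ _   = refl

      left-unique : ∀ {v u} → Left v u → left v ≡ u
      left-unique {v} r with left-view v
      left-unique (up q)       | _ , up _       = refl
      left-unique (up q)       | _ , down ¬q _  = contradiction q ¬q
      left-unique (up q)       | _ , flat ¬q _  = contradiction q ¬q
      left-unique (down ¬q _)  | _ , up q       = contradiction q ¬q
      left-unique (down _ _)   | _ , down _ _   = refl
      left-unique (down _ q)   | _ , flat _ ¬q  = contradiction q ¬q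
      left-unique (flat ¬q _)  | _ , up q       = contradiction q ¬q
      left-unique (flat _ ¬q)  | _ , down _ q   = contradiction q ¬q
      left-unique (flat _ _)   | _ , flat _ _   = refl

      edge : ∀ {u v} → Right u v ⊎ Left u v → E u v
      edge = [ inj₁ ∘ right-unique , inj₂ ∘ left-unique ]′

      edge⁻¹ : ∀ {u v} → E u v → Right u v ⊎ Left u v
      edge⁻¹ {u} (inj₁ refl) = inj₁ (proj₂ (right-view u))
      edge⁻¹ {u} (inj₂ refl) = inj₂ (proj₂ (left-view u))

      edge-s : ∀ {v} → ¬ Q v → ¬ Q (v ⊖ t) → E v (v ⊕ s)
      edge-s ¬q ¬q′ = edge (inj₁ (flat ¬q ¬q′))

      edge-t : ∀ {v} → Q v → E v (v ⊕ t)
      edge-t q = edge (inj₁ (up q))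

      edge-t′ : ∀ {v} → Q v → E (v ⊕ s) (v ⊕ s ⊕ t)
      edge-t′ {v} q = edge (inj₂ (up (subst Q (sym (⊕-⊖ v s)) q)))

      module _ (gen : Generic s t) (Q-s : ∀ {v} → Q v → ¬ Q (v ⊕ s)) (Q-t : ∀ {v} → Q v → ¬ Q (v ⊕ t)) where
        open Generic gen

        private
          -- Since `up` takes precedence over `down`, an exchanged edge is seen from its upper end
          -- only if no square stands directly on top of another; `Q-t` ensures this.
          right-sym : ∀ {u v} → Right u v → Right v u ⊎ Left v u
          right-sym {u} (up q) = inj₁ (subst (Right (u ⊕ t)) (⊕-⊖ u t) (down (Q-t q) (subst Q (sym (⊕-⊖ u t)) q)))
          right-sym {u} (down _ q) = inj₁ (subst (Right (u ⊖ t)) (⊖-⊕ u t) (up q))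
          right-sym {u} (flat ¬q ¬q′) = inj₂ (subst (Left (u ⊕ s)) (⊕-⊖ u s)
            (flat (λ q → ¬q (subst Q (⊕-⊖ u s) q)) (λ q → ¬q′ (subst (λ w → Q (w ⊖ t)) (⊕-⊖ u s) q))))

          left-sym : ∀ {u v} → Left u v → Right v u ⊎ Left v u
          left-sym {u} (up q) = inj₂ (subst (Left (u ⊕ t)) (⊕-⊖ u t)
            (down (λ q′ → Q-t q (subst Q (⊕-comm u t _) q′))
                  (subst Q (sym (trans (cong (_⊖ t) (⊕-comm u t _)) (⊕-⊖ (u ⊖ s) t))) q)))
          left-sym {u} (down _ q) = inj₂ (subst (Left (u ⊖ t)) (⊖-⊕ u t) (up (subst Q (⊖-comm u s t) q)))
          left-sym {u} (flat ¬q ¬q′) = inj₁ (subst (Right (u ⊖ s)) (⊖-⊕ u s) (flat ¬q ¬q′))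

          -- When both substitutes go up, or both go down, two squares would be side by side,
          -- against `Q-s`. Otherwise the two directions are distinct residues.
          right≢left : ∀ {v u w} → Right v u → Left v w → u ≢ w
          right≢left {v} (up q) (up q′) _ = Q-s q′ (subst Q (sym (⊖-⊕ v s)) q)
          right≢left {v} (up _) (down _ _) = ⊕≢⊖ v 2t≉0
          right≢left {v} (up _) (flat _ _) = ⊕≢⊖ v (Generic.s+t≉0 (generic-swap gen))
          right≢left {v} (down _ _) (up _) eq = ⊕≢⊖ v 2t≉0 (sym eq)
          right≢left {v} (down _ q) (down _ q′) _ =
            Q-s q′ (subst Q (trans (sym (⊖-⊕ (v ⊖ t) s)) (cong (_⊕ s) (⊖-comm v t s))) q)
          right≢left {v} (down _ _) (flat _ _) eq = ⊖≢⊖ v s≉t (sym eq)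
          right≢left {v} (flat _ _) (up _) = ⊕≢⊕ v s≉t
          right≢left {v} (flat _ _) (down _ _) = ⊕≢⊖ v s+t≉0
          right≢left {v} (flat _ _) (flat _ _) = ⊕≢⊖ v 2s≉0

          right-irr : ∀ {v u} → Right v u → u ≢ v
          right-irr {v} (up _) = ⊕-≢ v t≉0
          right-irr {v} (down _ _) = ⊖-≢ v t≉0
          right-irr {v} (flat _ _) = ⊕-≢ v s≉0

          left-irr : ∀ {v u} → Left v u → u ≢ v
          left-irr {v} (up _) = ⊕-≢ v t≉0
          left-irr {v} (down _ _) = ⊖-≢ v t≉0
          left-irr {v} (flat _ _) = ⊖-≢ v s≉0

        E-sym : ∀ {u v} → E u v → E v u
        E-sym e = [ edge ∘ right-sym , edge ∘ left-sym ]′ (edge⁻¹ e)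

        hamiltonian : InvariantsConstant E → HamiltonCycle n E
        hamiltonian connected = TwoRegular.hamiltonCycle n right left
          (λ v → right≢left (proj₂ (right-view v)) (proj₂ (left-view v)))
          (λ v → right-irr (proj₂ (right-view v))) (λ v → left-irr (proj₂ (left-view v)))
          (λ v → edge (right-sym (proj₂ (right-view v)))) (λ v → edge (left-sym (proj₂ (left-view v))))
          (λ f inv₀ inv₁ → connected f λ { {u} (inj₁ refl) → inv₀ u ; {u} (inj₂ refl) → inv₁ u })

    module _ {s t : ℕ} where
      private
        module A = Class s t
        module B = Class t s

      -- The edge changes class when it is the bottom (`Q v`) or the top (`Q (v ⊖ t)`) of a square.
      covering : ∀ v → A.E v (v ⊕ s) ⊎ B.E v (v ⊕ s)
      covering v with Q? v | Q? (v ⊖ t)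
      ... | yes q | _      = inj₂ (B.edge-t q)
      ... | no ¬q | yes q′ = inj₂ (subst (λ w → B.E w (w ⊕ s)) (⊖-⊕ v t) (B.edge-t′ q′))
      ... | no ¬q | no ¬q′ = inj₁ (A.edge-s ¬q ¬q′)

      module _ (gen : Generic s t) where
        open Generic gen

        private
          t+s≉0 : ¬ (t + s) ≈ 0 mod n
          t+s≉0 = Generic.s+t≉0 (generic-swap gen)

          -- Equal targets need equal directions among ±s and ±t, and where the directions agree the
          -- two classes make opposite claims about the same square. The other three combinations
          -- follow the same pattern.
          right-right : ∀ {v u w} → A.Right v u → B.Right v w → u ≢ w
          right-right {v} (A.up _) (B.up _) eq = ⊕≢⊕ v s≉t (sym eq)
          right-right (A.up q) (B.down ¬q _) _ = ¬q q
          right-right (A.up q) (B.flat ¬q _) _ = ¬q q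
          right-right (A.down ¬q _) (B.up q) _ = ¬q q
          right-right {v} (A.down _ _) (B.down _ _) eq = ⊖≢⊖ v s≉t (sym eq)
          right-right {v} (A.down _ _) (B.flat _ _) eq = ⊕≢⊖ v 2t≉0 (sym eq)
          right-right (A.flat ¬q _) (B.up q) _ = ¬q q
          right-right {v} (A.flat _ _) (B.down _ _) = ⊕≢⊖ v 2s≉0
          right-right {v} (A.flat _ _) (B.flat _ _) = ⊕≢⊕ v s≉t

          right-left : ∀ {v u w} → A.Right v u → B.Left v w → u ≢ w
          right-left {v} (A.up _) (B.up _) eq = ⊕≢⊕ v s≉t (sym eq)
          right-left {v} (A.up _) (B.down _ _) = ⊕≢⊖ v t+s≉0
          right-left {v} (A.up _) (B.flat _ _) = ⊕≢⊖ v 2t≉0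
          right-left {v} (A.down _ _) (B.up _) eq = ⊕≢⊖ v s+t≉0 (sym eq)
          right-left (A.down _ q) (B.down ¬q _) _ = ¬q q
          right-left (A.down _ q) (B.flat ¬q _) _ = ¬q q
          right-left (A.flat _ ¬q) (B.up q) _ = ¬q q
          right-left {v} (A.flat _ _) (B.down _ _) = ⊕≢⊖ v 2s≉0
          right-left {v} (A.flat _ _) (B.flat _ _) = ⊕≢⊖ v s+t≉0

          left-right : ∀ {v u w} → A.Left v u → B.Right v w → u ≢ w
          left-right {v} (A.up _) (B.up _) eq = ⊕≢⊕ v s≉t (sym eq)
          left-right {v} (A.up _) (B.down _ _) = ⊕≢⊖ v t+s≉0
          left-right (A.up q) (B.flat _ ¬q) _ = ¬q q
          left-right {v} (A.down _ _) (B.up _) eq = ⊕≢⊖ v s+t≉0 (sym eq)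
          left-right {v} (A.down ¬q _) (B.down _ q) _ = ¬q q
          left-right {v} (A.down _ _) (B.flat _ _) eq = ⊕≢⊖ v 2t≉0 (sym eq)
          left-right {v} (A.flat _ _) (B.up _) eq = ⊕≢⊖ v 2s≉0 (sym eq)
          left-right (A.flat ¬q _) (B.down _ q) _ = ¬q q
          left-right {v} (A.flat _ _) (B.flat _ _) eq = ⊕≢⊖ v t+s≉0 (sym eq)

          left-left : ∀ {v u w} → A.Left v u → B.Left v w → u ≢ w
          left-left {v} (A.up _) (B.up _) eq = ⊕≢⊕ v s≉t (sym eq)
          left-left {v} (A.up _) (B.down _ _) = ⊕≢⊖ v t+s≉0
          left-left {v} (A.up _) (B.flat _ _) = ⊕≢⊖ v 2t≉0
          left-left {v} (A.down _ _) (B.up _) eq = ⊕≢⊖ v s+t≉0 (sym eq)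
          left-left {v} (A.down _ _) (B.down _ _) eq = ⊖≢⊖ v s≉t (sym eq)
          left-left {v} (A.down _ q) (B.flat _ ¬q) _ = ¬q (subst Q (⊖-comm v s t) q)
          left-left {v} (A.flat _ _) (B.up _) eq = ⊕≢⊖ v 2s≉0 (sym eq)
          left-left {v} (A.flat _ ¬q) (B.down _ q) _ = ¬q (subst Q (⊖-comm v t s) q)
          left-left {v} (A.flat _ _) (B.flat _ _) = ⊖≢⊖ v s≉t

        disjoint : ∀ {u v} → A.E u v → B.E u v → ⊥
        disjoint a b with A.edge⁻¹ a | B.edge⁻¹ b
        ... | inj₁ r | inj₁ r′ = right-right r r′ refl
        ... | inj₁ r | inj₂ l′ = right-left r l′ refl
        ... | inj₂ l | inj₁ r′ = left-right l r′ refl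
        ... | inj₂ l | inj₂ l′ = left-left l l′ refl

    module Decomposition (n-even : parity n ≡ 0ℙ) {s t : ℕ} (gen : Generic s t)
      (Q-s : ∀ {v} → Q v → ¬ Q (v ⊕ s)) (Q-t : ∀ {v} → Q v → ¬ Q (v ⊕ t))
      (S-connected : InvariantsConstant (Class.E s t)) (T-connected : InvariantsConstant (Class.E t s)) where

      open Generic gen
      private
        module S = Class s t
        module T = Class t s

      abstract
        S-cycle : HamiltonCycle n S.E
        S-cycle = S.hamiltonian gen Q-s Q-t S-connected

        T-cycle : HamiltonCycle n T.E
        T-cycle = T.hamiltonian (generic-swap gen) Q-t Q-s T-connected

      open HamiltonCycle S-cycle public using () renaming (cycle to H₁; covers to S-covers; injective to H₁-injective; edge to H₁-edge)
      open HamiltonCycle T-cycle public using () renaming (cycle to H₂; covers to T-covers; injective to H₂-injective; edge to H₂-edge)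
      open PositionParity n-even S-cycle public using () renaming (colour to c₁; edge-flips to S-flips; oddDist to oddDist₁)
      open PositionParity n-even T-cycle public using () renaming (colour to c₂; edge-flips to T-flips; oddDist to oddDist₂)

      S-sym : ∀ {u v} → S.E u v → S.E v u
      S-sym = S.E-sym gen Q-s Q-t

      T-sym : ∀ {u v} → T.E u v → T.E v u
      T-sym = T.E-sym (generic-swap gen) Q-t Q-s

      private
        plus : ∀ v k → PlusJump n k v (v ⊕ k)
        plus v k = sym (toℕ-π (toℕ v + k))

        minus : ∀ v k → PlusJump n k (v ⊖ k) v
        minus v k = trans (plus (v ⊖ k) k) (cong toℕ (⊖-⊕ v k))

        plus⁻¹ : ∀ {u v k} → PlusJump n k u v → v ≡ u ⊕ k
        plus⁻¹ {u} {v} {k} e = toℕ-injective (trans (sym e) (sym (toℕ-π (toℕ u + k))))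

        S-adj : ∀ {u v} → S.E u v → Adj n s t u v
        S-adj {u} e with S.edge⁻¹ e
        ... | inj₁ (S.up _)     = inj₂ (inj₂ (inj₁ (plus u t)))
        ... | inj₁ (S.down _ _) = inj₂ (inj₂ (inj₂ (minus u t)))
        ... | inj₁ (S.flat _ _) = inj₁ (plus u s)
        ... | inj₂ (S.up _)     = inj₂ (inj₂ (inj₁ (plus u t)))
        ... | inj₂ (S.down _ _) = inj₂ (inj₂ (inj₂ (minus u t)))
        ... | inj₂ (S.flat _ _) = inj₂ (inj₁ (minus u s))

        T-adj : ∀ {u v} → T.E u v → Adj n s t u v
        T-adj {u} e with T.edge⁻¹ e
        ... | inj₁ (T.up _)     = inj₁ (plus u s)
        ... | inj₁ (T.down _ _) = inj₂ (inj₁ (minus u s))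
        ... | inj₁ (T.flat _ _) = inj₂ (inj₂ (inj₁ (plus u t)))
        ... | inj₂ (T.up _)     = inj₁ (plus u s)
        ... | inj₂ (T.down _ _) = inj₂ (inj₁ (minus u s))
        ... | inj₂ (T.flat _ _) = inj₂ (inj₂ (inj₂ (minus u t)))

        Covered : V → V → Set
        Covered x y = CycEdge n H₁ x y ⊎ CycEdge n H₂ x y

        covers : ∀ x y → Adj n s t x y → Covered x y
        covers x y (inj₁ e) = subst (Covered x) (sym (plus⁻¹ {k = s} e)) (Data.Sum.map S-covers T-covers (covering {s} {t} x))
        covers x y (inj₂ (inj₁ e)) = subst (λ v → Covered v y) (sym (plus⁻¹ {k = s} e))
          (Data.Sum.map (S-covers ∘ S-sym) (T-covers ∘ T-sym) (covering {s} {t} y))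
        covers x y (inj₂ (inj₂ (inj₁ e))) = subst (Covered x) (sym (plus⁻¹ {k = t} e))
          (Data.Sum.swap (Data.Sum.map T-covers S-covers (covering {t} {s} x)))
        covers x y (inj₂ (inj₂ (inj₂ e))) = subst (λ v → Covered v y) (sym (plus⁻¹ {k = t} e))
          (Data.Sum.swap (Data.Sum.map (T-covers ∘ T-sym) (S-covers ∘ S-sym) (covering {t} {s} y)))

        S-cycEdge : ∀ {x y} → CycEdge n H₁ x y → S.E x y
        S-cycEdge (i , j , c , inj₁ (refl , refl)) = H₁-edge i j c
        S-cycEdge (i , j , c , inj₂ (refl , refl)) = S-sym (H₁-edge i j c)

        T-cycEdge : ∀ {x y} → CycEdge n H₂ x y → T.E x y
        T-cycEdge (i , j , c , inj₁ (refl , refl)) = H₂-edge i j c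
        T-cycEdge (i , j , c , inj₂ (refl , refl)) = T-sym (H₂-edge i j c)

      isHamDecomp : IsHamDecomp n s t H₁ H₂
      isHamDecomp = (H₁-injective , λ i j c → S-adj (H₁-edge i j c)) , (H₂-injective , λ i j c → T-adj (H₂-edge i j c)) ,
        covers , λ x y e₁ e₂ → disjoint gen (S-cycEdge e₁) (T-cycEdge e₂)

      private
        corners-distinct : ∀ w → let x = w ⊕ s; y = w ⊕ s ⊕ t; z = w ⊕ t in
          w ≢ x × w ≢ y × w ≢ z × x ≢ y × x ≢ z × y ≢ z
        corners-distinct w =
          (λ e → ⊕-≢ w s≉0 (sym e)) ,
          (λ e → ⊕-≢ w s+t≉0 (trans (sym (⊕-⊕ w s t)) (sym e))) ,
          (λ e → ⊕-≢ w t≉0 (sym e)) ,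
          (λ e → ⊕-≢ (w ⊕ s) t≉0 (sym e)) ,
          ⊕≢⊕ w s≉t ,
          (λ e → ⊕-≢ w s≉0 (⊕-cancelʳ t e))

      -- The corner opposite to `w` is one step of `H₁` away from `w ⊕ s` and one step of `H₂` away
      -- from `w ⊕ t`, so equality of colours at these corners becomes odd distance.
      exchanged-square : ∀ w → Q w → c₁ (w ⊕ s) ≡ c₁ w → c₂ (w ⊕ t) ≡ c₂ w → Q₂ n H₁ H₂
      exchanged-square w q e₁ e₂ = w , w ⊕ s , w ⊕ s ⊕ t , w ⊕ t ,
        (corners-distinct w , inj₂ (T-covers (T.edge-t q) ,
          T-covers (subst (λ y → T.E y (w ⊕ t)) (⊕-comm w t s) (T-sym (T.edge-t′ q))) ,
          S-covers (S.edge-t′ q) , S-covers (S-sym (S.edge-t q)))) ,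
        inj₁ (oddDist₁ (trans (S-flips (S.edge-t′ q)) (cong _⁻¹ e₁)) ,
              oddDist₂ (trans (cong c₂ (⊕-comm w s t)) (trans (T-flips (T.edge-t′ q)) (cong _⁻¹ e₂))))

      -- The s-edges of the square cannot lie in H₂, where they would flip c₂.
      unexchanged-square : ∀ w → T.E w (w ⊕ t) → T.E (w ⊕ s) (w ⊕ s ⊕ t) → c₂ (w ⊕ s) ≡ c₂ w → c₁ (w ⊕ t) ≡ c₁ w → Q₂ n H₁ H₂
      unexchanged-square w wz xy e₂ e₁ = w , w ⊕ s , w ⊕ s ⊕ t , w ⊕ t ,
        (corners-distinct w , inj₁ (S-covers (s-edge w e₂) , S-covers (S-sym zy) , T-covers xy , T-covers (T-sym wz))) ,
        inj₁ (oddDist₁ (trans (S-flips zy) (cong _⁻¹ e₁)) , oddDist₂ (trans (T-flips xy) (cong _⁻¹ e₂)))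
        where
        s-edge : ∀ v → c₂ (v ⊕ s) ≡ c₂ v → S.E v (v ⊕ s)
        s-edge v e with covering {s} {t} v
        ... | inj₁ a = a
        ... | inj₂ b = contradiction (trans (sym e) (T-flips b)) (p≢p⁻¹ (c₂ v))
        zy : S.E (w ⊕ t) (w ⊕ s ⊕ t)
        zy = subst (S.E (w ⊕ t)) (⊕-comm w t s) (s-edge (w ⊕ t) (begin
          c₂ (w ⊕ t ⊕ s)   ≡⟨ cong c₂ (⊕-comm w t s) ⟩
          c₂ (w ⊕ s ⊕ t)   ≡⟨ T-flips xy ⟩
          c₂ (w ⊕ s) ⁻¹    ≡⟨ cong _⁻¹ e₂ ⟩
          c₂ w ⁻¹          ≡⟨ sym (T-flips wz) ⟩
          c₂ (w ⊕ t)       ∎))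
          where open ≡-Reasoning

-- The staircase with its zigzag

zig : ℕ → ℕ
zig 0             = 0
zig 1             = 1
zig (suc (suc k)) = zig k

zig-even : ∀ k → parity k ≡ 0ℙ → zig k ≡ 0
zig-even 0             _ = refl
zig-even (suc (suc k)) e = zig-even k e

zig-odd : ∀ k → parity k ≡ 1ℙ → zig k ≡ 1
zig-odd 1             _ = refl
zig-odd (suc (suc k)) e = zig-odd k e

zig≤1 : ∀ k → zig k ≤ 1
zig≤1 0             = z≤n
zig≤1 1             = s≤s z≤n
zig≤1 (suc (suc k)) = zig≤1 k

zig-step : ∀ k → zig (suc k) ≡ suc (zig k) ⊎ zig k ≡ suc (zig (suc k))
zig-step 0             = inj₁ refl
zig-step 1             = inj₂ refl
zig-step (suc (suc k)) = zig-step k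

module Zigzag (D : ℕ) where

  abstract
    J : ℕ → ℕ
    J i with i ≤? D
    ... | yes _ = i
    ... | no  _ = D + zig (i ∸ D)

    J-low : ∀ {i} → i ≤ D → J i ≡ i
    J-low {i} i≤D with i ≤? D
    ... | yes _   = refl
    ... | no i≰D = contradiction i≤D i≰D

    J-zig : ∀ k → J (D + k) ≡ D + zig k
    J-zig k with (D + k) ≤? D
    J-zig k | no _ = cong (λ z → D + zig z) (m+n∸m≡n D k)
    J-zig zero | yes _ = refl
    J-zig (suc k) | yes le = contradiction le (m+1+n≰m D)

  split : ∀ i → i ≤ D ⊎ ∃ λ k → i ≡ D + suc k
  split i with i ≤? D
  ... | yes i≤D = inj₁ i≤D
  ... | no  i≰D with m≤n⇒∃[o]m+o≡n (≰⇒> i≰D)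
  ...   | k , refl = inj₂ (k , sym (+-suc D k))

  J-step : ∀ i → J (suc i) ≡ suc (J i) ⊎ J i ≡ suc (J (suc i))
  J-step i with split (suc i)
  ... | inj₁ i<D = inj₁ (trans (J-low i<D) (cong suc (sym (J-low (<⇒≤ i<D)))))
  ... | inj₂ (k , e) with suc-injective (trans e (+-suc D k))
  ...   | refl = Data.Sum.map
    (λ z → trans J-suc (trans (cong (D +_) z) (trans (+-suc D (zig k)) (cong suc (sym (J-zig k))))))
    (λ z → trans (J-zig k) (trans (cong (D +_) z) (trans (+-suc D _) (cong suc (sym J-suc)))))
    (zig-step k)
    where
    J-suc : J (suc (D + k)) ≡ D + zig (suc k)
    J-suc = trans (cong J (sym (+-suc D k))) (J-zig (suc k))

  J≤1+D : ∀ i → J i ≤ suc D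
  J≤1+D i with split i
  ... | inj₁ i≤D = ≤-trans (≤-reflexive (J-low i≤D)) (≤-trans i≤D (n≤1+n D))
  ... | inj₂ (k , refl) = ≤-trans (≤-reflexive (J-zig (suc k)))
    (≤-trans (+-monoʳ-≤ D (zig≤1 (suc k))) (≤-reflexive (+-comm D 1)))

-- `K` counts the zigzag squares above level `D`. In the first alternative of `mode` the `R` squares
-- close up around the rows; in the second, the `R - 1` squares leave a gap. The condition `0 < K`
-- provides the one diagonal square beyond `D` that is needed in `diagonal`.
module Construction (n : ℕ) .{{_ : NonZero n}} (n-even : parity n ≡ 0ℙ) (s t R C D K : ℕ)
  (gen : Exchange.Generic n s t) (rows : Residues.Cosets n s t R) (cols : Residues.Cosets n t s C)
  (D-even : parity D ≡ 0ℙ) (K-even : parity K ≡ 0ℙ)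
  (mode : (R ≡ 1 + (D + K) × C ≡ 2 + D × 0 < K) ⊎ (R ≡ 2 + (D + K) × C ≡ 1 + D))
  where

  open Residues n
  open Exchange n
  open Generic gen
  open Zigzag D
  open Cosets rows using () renaming (kind to row; kind-g to row-s; kind-π to row-π; kind-π-N to row-π-R; reach to row-reach; order to row-order; order*N≡n to row-order*R; order*g≈0 to row-order*s; order∣ to row-order∣)
  open Cosets cols using () renaming (kind to col; kind-π to col-π; kind-π-N to col-π-C; reach to col-reach; order to col-order; order*N≡n to col-order*C; order∣ to col-order∣)
  module Row = Orbits rows
  module Col = Orbits cols

  M : ℕ
  M = D + K

  D≤M : D ≤ M
  D≤M = m≤m+n D K

  M-even : parity M ≡ 0ℙ
  M-even = trans (+-homo-+ D K) (cong₂ _⊞_ D-even K-even)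

  M<R : M < R
  M<R = [ (λ e → ≤-reflexive (sym (proj₁ e))) , (λ e → ≤-trans (n≤1+n _) (≤-reflexive (sym (proj₁ e)))) ]′ mode

  D<C : D < C
  D<C = [ (λ e → ≤-trans (n≤1+n _) (≤-reflexive (sym (proj₁ (proj₂ e))))) , (λ e → ≤-reflexive (sym (proj₂ e))) ]′ mode

  J-M : J M ≡ D
  J-M = trans (J-zig K) (trans (cong (D +_) (zig-even K K-even)) (+-identityʳ D))

  abstract
    pt : ℕ → ℕ → V
    pt i j = π (i * t + j * s)

    pt-s : ∀ i j → pt i j ⊕ s ≡ pt i (suc j)
    pt-s i j = trans (π-⊕ _ s) (cong π (lemma (i * t) (j * s) s))
      where
      lemma : ∀ x y z → x + y + z ≡ x + (z + y)
      lemma = solve-∀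

    pt-t : ∀ i j → pt i j ⊕ t ≡ pt (suc i) j
    pt-t i j = trans (π-⊕ _ t) (cong π (lemma (i * t) (j * s) t))
      where
      lemma : ∀ x y z → x + y + z ≡ z + x + y
      lemma = solve-∀

    pt-m*s : ∀ i j → pt i 0 ⊕ j * s ≡ pt i j
    pt-m*s i j = trans (π-⊕ _ (j * s)) (cong (λ z → π (z + j * s)) (+-identityʳ (i * t)))

    pt-m*t : ∀ i j → pt 0 j ⊕ i * t ≡ pt i j
    pt-m*t i j = trans (π-⊕ _ (i * t)) (cong π (+-comm (j * s) (i * t)))

    row-pt : ∀ {i} j → i < R → row (pt i j) ≡ i
    row-pt {i} j = row-π i j

    col-pt : ∀ i {j} → j < C → col (pt i j) ≡ j
    col-pt i {j} j<C = trans (cong (col ∘ π) (+-comm (i * t) (j * s))) (col-π j i j<C)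

    col-pt-C : ∀ i → col (pt i C) ≡ 0
    col-pt-C i = trans (cong (col ∘ π) (+-comm (i * t) (C * s))) (col-π-C i)

    row-pt-R : ∀ j → row (pt R j) ≡ 0
    row-pt-R j = row-π-R j

    pt-injective : ∀ {i j i′ j′} → pt i j ≡ pt i′ j′ → (i * t + j * s) ≈ (i′ * t + j′ * s) mod n
    pt-injective = π-injective

  pt-suc≢ : ∀ i j → pt i j ≢ pt i (suc j)
  pt-suc≢ i j e = ⊕-≢ (pt i j) s≉0 (trans (pt-s i j) (sym e))

  pt-2+≢ : ∀ i j → pt i j ≢ pt i (2 + j)
  pt-2+≢ i j e = ⊕-≢ (pt i j) 2s≉0 (trans (sym (⊕-⊕ (pt i j) s s)) (trans (cong (_⊕ s) (pt-s i j)) (trans (pt-s i (suc j)) (sym e))))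

  q : ℕ → V
  q i = pt i (J i)

  q-low : ∀ {i} → i ≤ D → q i ≡ pt i i
  q-low {i} i≤D = cong (pt i) (J-low i≤D)

  row-q : ∀ {i} → i ≤ M → row (q i) ≡ i
  row-q i≤M = row-pt _ (≤-<-trans i≤M M<R)

  row-q-s : ∀ {i} → i ≤ M → row (q i ⊕ s) ≡ i
  row-q-s i≤M = trans (row-s _) (row-q i≤M)

  -- Reading the level off the row makes the predicate decidable and leaves at most one corner per
  -- row.
  Q : V → Set
  Q v = row v ≤ M × v ≡ q (row v)

  Q? : ∀ v → Dec (Q v)
  Q? v = (row v ≤? M) ×-dec (v ≟ q (row v))

  Q-q : ∀ {i} → i ≤ M → Q (q i)
  Q-q {i} i≤M = subst (_≤ M) (sym (row-q i≤M)) i≤M , cong q (sym (row-q i≤M))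

  ¬Q : ∀ {v} → (∀ i → i ≤ M → v ≢ q i) → ¬ Q v
  ¬Q {v} none (le , e) = none (row v) le e

  ¬Q-⊖ : ∀ {v} k → (∀ i → i ≤ M → v ≢ q i ⊕ k) → ¬ Q (v ⊖ k)
  ¬Q-⊖ {v} k none (le , e) = none (row (v ⊖ k)) le (trans (sym (⊖-⊕ v k)) (cong (_⊕ k) e))

  Q-s : ∀ {v} → Q v → ¬ Q (v ⊕ s)
  Q-s {v} (_ , e) (_ , e′) = ⊕-≢ v s≉0 (trans e′ (trans (cong q (row-s v)) (sym e)))

  private
    adjacent-rows : ∀ i → pt (suc i) (J i) ≢ q (suc i)
    adjacent-rows i e with J-step i
    ... | inj₁ up   = pt-suc≢ (suc i) (J i) (trans e (cong (pt (suc i)) up))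
    ... | inj₂ down = pt-suc≢ (suc i) (J (suc i)) (trans (sym e) (cong (pt (suc i)) down))

    -- For C = 2 the rows would have length at most 2.
    Rt≉0 : C ≡ 2 → ¬ (R * t) ≈ 0 mod n
    Rt≉0 C≡2 Rt≈0 with col-order∣ Rt≈0
    ... | divides x R≡ = 2s≉0 (subst (_≈ 0 mod n) (cong (s +_) (+-identityʳ s)) (subst (λ z → (z * s) ≈ 0 mod n) 2≡
          (≈-trans (≈-reflexive (*-assoc x row-order s)) (≈-trans (≈-*ˡ x row-order*s) (≈-reflexive (*-zeroʳ x))))))
      where
      open ≡-Reasoning
      lemma : ∀ x a b → x * a * b ≡ a * (x * b)
      lemma = solve-∀
      2≡ : x * row-order ≡ 2
      2≡ = *-cancelʳ-≡ (x * row-order) 2 col-order {{≢-nonZero Col.order≢0}} (begin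
        x * row-order * col-order   ≡⟨ lemma x row-order col-order ⟩
        row-order * (x * col-order) ≡⟨ cong (row-order *_) (sym R≡) ⟩
        row-order * R               ≡⟨ row-order*R ⟩
        n                           ≡⟨ sym col-order*C ⟩
        col-order * C               ≡⟨ cong (col-order *_) C≡2 ⟩
        col-order * 2               ≡⟨ *-comm col-order 2 ⟩
        2 * col-order               ∎)

    last-row : R ≡ suc M → C ≡ 2 + D → pt (suc M) D ≢ q 0
    last-row R≡ C≡ e = case D ≟ᴺ 0 of λ
      { (yes D≡0) → Rt≉0 (trans C≡ (cong (2 +_) D≡0))
          (subst (λ z → (z * t) ≈ 0 mod n) (sym R≡) (≈-cancel (D * s) (0 * s)
            (pt-injective (trans e (q-low z≤n))) (≈-reflexive (cong (_* s) D≡0))))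
      ; (no D≢0) → D≢0 (trans (sym (col-pt (suc M) D<C)) (trans (cong col (trans e (q-low z≤n))) (col-pt 0 (≤-<-trans z≤n D<C)))) }

  -- Corners in successive rows differ by one column. At the wrap from the last row to row 0,
  -- columns `D` and 0 keep them apart, except for `D = 0`, where `C = 2` and `Rt≉0` steps in.
  Q-t : ∀ {v} → Q v → ¬ Q (v ⊕ t)
  Q-t {v} (i≤M , e) (i′≤M , e′) = case suc (row v) <? R of λ
    { (yes 1+i<R) → adjacent-rows (row v) (trans at-next (cong q (trans (cong row above) (row-pt _ 1+i<R))))
    ; (no  1+i≮R) → case mode of λ
        { (inj₂ (R≡ , _)) → 1+i≮R (≤-trans (s≤s (s≤s i≤M)) (≤-reflexive (sym R≡)))
        ; (inj₁ (R≡ , C≡ , _)) → wrap R≡ C≡ (≤-antisym i≤M (m<1+n⇒m≤n (≤-trans (≤-reflexive (sym R≡)) (≮⇒≥ 1+i≮R)))) } }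
    where
    above : v ⊕ t ≡ pt (suc (row v)) (J (row v))
    above = trans (cong (_⊕ t) e) (pt-t _ _)
    at-next : pt (suc (row v)) (J (row v)) ≡ q (row (v ⊕ t))
    at-next = trans (sym above) e′
    wrap : R ≡ suc M → C ≡ 2 + D → row v ≡ M → ⊥
    wrap R≡ C≡ i≡M = last-row R≡ C≡ (trans (sym above-M) (trans e′ (cong q row≡0)))
      where
      above-M : v ⊕ t ≡ pt (suc M) D
      above-M = trans above (trans (cong (λ z → pt (suc z) (J z)) i≡M) (cong (pt (suc M)) J-M))
      row≡0 : row (v ⊕ t) ≡ 0
      row≡0 = trans (cong row (trans above-M (cong (λ z → pt z D) (sym R≡)))) (row-pt-R D)

  open Corners Q Q?
  module S = Class s t
  module T = Class t s

  S-step : ∀ v → (∀ i → i ≤ M → v ≢ q i × v ≢ q i ⊕ t) → S.E v (v ⊕ s)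
  S-step v none = S.edge-s (¬Q λ i le → proj₁ (none i le)) (¬Q-⊖ t λ i le → proj₂ (none i le))

  T-step : ∀ v → (∀ i → i ≤ M → v ≢ q i × v ≢ q i ⊕ s) → T.E v (v ⊕ t)
  T-step v none = T.edge-s (¬Q λ i le → proj₁ (none i le)) (¬Q-⊖ s λ i le → proj₂ (none i le))

  -- A vertical edge above row `i` can be lost only to the square between rows `i` and `i + 1`, and
  -- the row determines that square.
  T-vertical : ∀ {i} j → i ≤ M → pt i j ≢ q i → pt i j ≢ q i ⊕ s → T.E (pt i j) (pt (suc i) j)
  T-vertical {i} j i≤M ≢q ≢q-s = subst (T.E (pt i j)) (pt-t i j) (T-step (pt i j) λ k k≤M →
    (λ e → ≢q (trans e (cong q (same k k≤M (trans (cong row e) (row-q k≤M)))))) ,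
    (λ e → ≢q-s (trans e (cong (λ z → q z ⊕ s) (same k k≤M (trans (cong row e) (row-q-s k≤M)))))))
    where
    same : ∀ k → k ≤ M → row (pt i j) ≡ k → k ≡ i
    same k k≤M e = trans (sym e) (row-pt j (≤-<-trans i≤M M<R))

  bottom : ∀ {i j} → i ≤ M → J i ≡ j → T.E (pt i j) (pt i (suc j))
  bottom {i} i≤M refl = subst (T.E (q i)) (pt-s _ _) (T.edge-t (Q-q i≤M))

  top : ∀ {i j} → i ≤ M → J i ≡ j → T.E (pt (suc i) j) (pt (suc i) (suc j))
  top {i} i≤M refl = subst (λ v → T.E v (pt (suc i) (suc (J i)))) (pt-t _ _)
    (subst (T.E (q i ⊕ t)) (trans (cong (_⊕ s) (pt-t _ _)) (pt-s _ _)) (T.edge-t′ (Q-q i≤M)))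

  private
    J-even : ∀ k → parity k ≡ 0ℙ → J (D + k) ≡ D
    J-even k e = trans (J-zig k) (trans (cong (D +_) (zig-even k e)) (+-identityʳ D))

    J-odd : ∀ k → parity k ≡ 1ℙ → J (D + k) ≡ suc D
    J-odd k e = trans (J-zig k) (trans (cong (D +_) (zig-odd k e)) (+-comm D 1))

  even-or-odd : ∀ k → parity k ≡ 0ℙ ⊎ parity k ≡ 1ℙ
  even-or-odd k with parity k
  ... | 0ℙ = inj₁ refl
  ... | 1ℙ = inj₂ refl

  even⇒suc-odd : ∀ k → parity k ≡ 0ℙ → parity (suc k) ≡ 1ℙ
  even⇒suc-odd k e = trans (parity-suc k) (cong _⁻¹ e)

  suc-odd⇒even : ∀ k → parity (suc k) ≡ 1ℙ → parity k ≡ 0ℙ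
  suc-odd⇒even k e = ⁻¹-injective (trans (sym (parity-suc k)) e)

  suc-even⇒odd : ∀ k → parity (suc k) ≡ 0ℙ → parity k ≡ 1ℙ
  suc-even⇒odd k e = ⁻¹-injective (trans (sym (parity-suc k)) e)

  -- Above level D every row of the zigzag contains both horizontal edges, one from the square
  -- below and one from the square above.
  zig-row : ∀ k → D + suc k ≤ M →
    T.E (pt (D + suc k) D) (pt (D + suc k) (1 + D)) × T.E (pt (D + suc k) (1 + D)) (pt (D + suc k) (2 + D))
  zig-row k le with even-or-odd (suc k)
  ... | inj₁ e = bottom le (J-even (suc k) e) ,
        subst (λ i → T.E (pt i (1 + D)) (pt i (2 + D))) (sym (+-suc D k)) (top (≤-trans (+-monoʳ-≤ D (n≤1+n k)) le) (J-odd k (suc-even⇒odd k e)))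
  ... | inj₂ e = subst (λ i → T.E (pt i D) (pt i (1 + D))) (sym (+-suc D k)) (top (≤-trans (+-monoʳ-≤ D (n≤1+n k)) le) (J-even k (suc-odd⇒even k e))) ,
        bottom le (J-odd (suc k) e)

  zig-row-suc : ∀ k → suc (D + suc k) ≤ M →
    T.E (pt (suc (D + suc k)) D) (pt (suc (D + suc k)) (1 + D)) × T.E (pt (suc (D + suc k)) (1 + D)) (pt (suc (D + suc k)) (2 + D))
  zig-row-suc k le = subst (λ i → T.E (pt i D) (pt i (1 + D)) × T.E (pt i (1 + D)) (pt i (2 + D))) (+-suc D (suc k))
    (zig-row (suc k) (subst (_≤ M) (sym (+-suc D (suc k))) le))

  -- At odd height above level `D` the square occupies columns `D + 1` and `D + 2`, so column `D`
  -- keeps its edge; at even height it is column `D + 2` that does.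
  zig-column-D : ∀ k → parity (suc k) ≡ 1ℙ → D + suc k ≤ M → T.E (pt (D + suc k) D) (pt (suc (D + suc k)) D)
  zig-column-D k odd le = T-vertical D le
    (λ e → pt-suc≢ _ D (trans e (cong (pt _) (J-odd (suc k) odd))))
    (λ e → pt-2+≢ _ D (trans e (trans (pt-s _ _) (cong (λ j → pt (D + suc k) (suc j)) (J-odd (suc k) odd)))))

  zig-column-2+D : ∀ k → parity (suc k) ≡ 0ℙ → D + suc k ≤ M → T.E (pt (D + suc k) (2 + D)) (pt (suc (D + suc k)) (2 + D))
  zig-column-2+D k even le = T-vertical (2 + D) le
    (λ e → pt-2+≢ _ D (sym (trans e (cong (pt _) (J-even (suc k) even)))))
    (λ e → pt-suc≢ _ (suc D) (sym (trans e (trans (pt-s _ _) (cong (λ j → pt (D + suc k) (suc j)) (J-even (suc k) even))))))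

  -- Connectedness of the two classes

  S-connected : InvariantsConstant S.E
  S-connected f inv = Row.Staircase.constant f q (λ i → q i ⊕ t) M
    (λ v none → inv (S-step v none))
    (λ i i≤M → sym (inv (S.edge-t (Q-q i≤M))))
    (λ i i≤M → sym (trans (cong f (⊕-comm (q i) t s)) (inv (S.edge-t′ (Q-q i≤M)))))
    (λ i i≤M → row-q i≤M)
    (λ i i<M → trans (cong row (pt-t i (J i))) (row-pt _ (≤-<-trans i<M M<R)))
    (Data.Sum.swap (Data.Sum.map
      (λ e → trans (cong row (pt-t M (J M))) (trans (cong (λ z → row (pt z (J M))) (sym (proj₁ e))) (row-pt-R _)) , proj₁ e , M-even)
      (λ e → trans (cong row (pt-t M (J M))) (row-pt _ (≤-reflexive (sym (proj₁ e)))) , proj₁ e)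
      mode))

  -- Overwriting f on the two zigzag columns above level D by its value on top of the last square
  -- turns the zigzag into the single square of level D.
  module Straighten (f : V → Parity) (inv : ∀ {u v} → T.E u v → f v ≡ f u) where

    Z : V → Set
    Z v = (D < row v × row v ≤ M) × (v ≡ pt (row v) D ⊎ v ≡ pt (row v) (1 + D))

    Z? : ∀ v → Dec (Z v)
    Z? v = ((D <? row v) ×-dec (row v ≤? M)) ×-dec ((v ≟ pt (row v) D) ⊎-dec (v ≟ pt (row v) (1 + D)))

    τ : Parity
    τ = f (pt (suc M) D)

    abstract
      f̃ : V → Parity
      f̃ v with Z? v
      ... | yes _ = τ
      ... | no  _ = f v

      f̃-Z : ∀ {v} → Z v → f̃ v ≡ τ
      f̃-Z {v} z with Z? v
      ... | yes _ = refl
      ... | no ¬z = contradiction z ¬z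

      f̃-¬Z : ∀ {v} → ¬ Z v → f̃ v ≡ f v
      f̃-¬Z {v} ¬z with Z? v
      ... | yes z = contradiction z ¬z
      ... | no  _ = refl

    low⇒¬Z : ∀ {v} → row v ≤ D → ¬ Z v
    low⇒¬Z le ((gt , _) , _) = <-irrefl refl (<-≤-trans gt le)

    Z-D : ∀ {i} → D < i → i ≤ M → Z (pt i D)
    Z-D {i} gt le = (subst (D <_) (sym r) gt , subst (_≤ M) (sym r) le) , inj₁ (cong (λ z → pt z D) (sym r))
      where
      r : row (pt i D) ≡ i
      r = row-pt D (≤-<-trans le M<R)

    Z-1+D : ∀ {i} → D < i → i ≤ M → Z (pt i (1 + D))
    Z-1+D {i} gt le = (subst (D <_) (sym r) gt , subst (_≤ M) (sym r) le) , inj₂ (cong (λ z → pt z (1 + D)) (sym r))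
      where
      r : row (pt i (1 + D)) ≡ i
      r = row-pt (1 + D) (≤-<-trans le M<R)

    D<D+1+k : ∀ k → D < D + suc k
    D<D+1+k k = subst (D <_) (sym (+-suc D k)) (s≤s (m≤m+n D k))

    D+odd≢M : ∀ k → parity k ≡ 1ℙ → D + k ≢ M
    D+odd≢M k odd e = contradiction (trans (sym odd) (trans (cong parity (+-cancelˡ-≡ D k K e)) K-even)) λ ()

    -- Above a vertex of `Z` lies either `Z` again or an upper corner of the last square, where `f`
    -- takes the value `τ`.
    leaving-Z : ∀ {i} j → i ≤ M → (suc i ≤ M → Z (pt (suc i) j)) → f (pt (suc M) j) ≡ τ →
      f̃ (pt i j ⊕ t) ≡ τ
    leaving-Z {i} j i≤M next last with suc i ≤? M
    ... | yes i<M = trans (cong f̃ (pt-t i j)) (f̃-Z (next i<M))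
    ... | no  i≮M with ≤-antisym i≤M (≮⇒≥ i≮M)
    ...   | refl = trans (cong f̃ (pt-t i j)) (trans (f̃-¬Z outside) last)
      where
      outside : ¬ Z (pt (suc M) j)
      outside ((gt , le) , _) = case mode of λ
        { (inj₁ (R≡ , _)) → <-irrefl refl (≤-<-trans z≤n (subst (D <_) (trans (cong (λ z → row (pt z j)) (sym R≡)) (row-pt-R j)) gt))
        ; (inj₂ (R≡ , _)) → <-irrefl refl (subst (_≤ M) (row-pt j (≤-reflexive (sym R≡))) le) }

    entering-Z : ∀ {v i} j → D < i → v ⊕ t ≡ pt i j → v ≡ pt (pred i) j
    entering-Z {i = suc i} j _ e = ⊕-cancelʳ t (trans e (sym (pt-t i j)))

    snake : ∀ k → D + suc k ≤ M → f (pt (D + suc k) D) ≡ f (pt (D + suc k) (2 + D)) × f (pt (D + suc k) (1 + D)) ≡ f (pt (D + suc k) (2 + D))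
    snake k le = let (a , b) = zig-row k le in trans (sym (inv a)) (sym (inv b)) , sym (inv b)

    -- The edge in column `D + 2` is exchanged at this height, but the class makes a detour: along
    -- the row to column `D`, up, and back along the next row.
    snake-up : ∀ k → parity (suc k) ≡ 1ℙ → D + suc k ≤ M → f (pt (D + suc k) (2 + D) ⊕ t) ≡ f (pt (D + suc k) (2 + D))
    snake-up k odd le = begin
      f (pt (D + suc k) (2 + D) ⊕ t)     ≡⟨ cong f (pt-t _ _) ⟩
      f (pt (suc (D + suc k)) (2 + D))   ≡⟨ cong (λ z → f (pt z (2 + D))) (sym (+-suc D (suc k))) ⟩
      f (pt (D + suc (suc k)) (2 + D))   ≡⟨ sym (proj₁ (snake (suc k) le′)) ⟩
      f (pt (D + suc (suc k)) D)         ≡⟨ cong (λ z → f (pt z D)) (+-suc D (suc k)) ⟩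
      f (pt (suc (D + suc k)) D)         ≡⟨ inv (zig-column-D k odd le) ⟩
      f (pt (D + suc k) D)               ≡⟨ proj₁ (snake k le) ⟩
      f (pt (D + suc k) (2 + D))         ∎
      where
      open ≡-Reasoning
      le′ : D + suc (suc k) ≤ M
      le′ = subst (_≤ M) (sym (+-suc D (suc k))) (≤∧≢⇒< le (D+odd≢M (suc k) odd))

    inv-outside : ∀ v → (∀ i → i ≤ D → v ≢ q i × v ≢ q i ⊕ s) → ¬ Z v → f (v ⊕ t) ≡ f v
    inv-outside v none ¬z with anyUpTo? (λ i → (v ≟ q i) ⊎-dec (v ≟ q i ⊕ s)) (suc M)
    ... | no  none′ = inv (T-step v λ i le → (λ e → none′ (i , s≤s le , inj₁ e)) , (λ e → none′ (i , s≤s le , inj₂ e)))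
    ... | yes (i , s≤s i≤M , e) with split i
    ...   | inj₁ i≤D = ⊥-elim ([ proj₁ (none i i≤D) , proj₂ (none i i≤D) ]′ e)
    ...   | inj₂ (k , refl) with even-or-odd (suc k) | e
    ...     | inj₁ even | inj₁ refl = contradiction (subst Z (cong (pt (D + suc k)) (sym (J-even (suc k) even))) (Z-D (D<D+1+k k) i≤M)) ¬z
    ...     | inj₁ even | inj₂ refl = contradiction (subst Z (trans (cong (λ j → pt (D + suc k) (suc j)) (sym (J-even (suc k) even))) (sym (pt-s _ _)))
                                        (Z-1+D (D<D+1+k k) i≤M)) ¬z
    ...     | inj₂ odd  | inj₁ refl = contradiction (subst Z (cong (pt (D + suc k)) (sym (J-odd (suc k) odd))) (Z-1+D (D<D+1+k k) i≤M)) ¬z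
    ...     | inj₂ odd  | inj₂ refl = subst (λ u → f (u ⊕ t) ≡ f u)
                                        (trans (cong (λ j → pt (D + suc k) (suc j)) (sym (J-odd (suc k) odd))) (sym (pt-s _ _))) (snake-up k odd i≤M)

    inv-f̃ : ∀ v → (∀ i → i ≤ D → v ≢ q i × v ≢ q i ⊕ s) → f̃ (v ⊕ t) ≡ f̃ v
    inv-f̃ v none with Z? v | Z? (v ⊕ t)
    ... | yes z@((gt , le) , inj₁ e) | _ = trans (cong (λ u → f̃ (u ⊕ t)) e)
        (trans (leaving-Z D le (Z-D (m<n⇒m<1+n gt)) refl) (sym (f̃-Z z)))
    ... | yes z@((gt , le) , inj₂ e) | _ = trans (cong (λ u → f̃ (u ⊕ t)) e)
        (trans (leaving-Z (1 + D) le (Z-1+D (m<n⇒m<1+n gt)) (inv (top ≤-refl J-M))) (sym (f̃-Z z)))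
    ... | no ¬z | no ¬z′ = trans (f̃-¬Z ¬z′) (trans (inv-outside v none ¬z) (sym (f̃-¬Z ¬z)))
    -- `Z` can be entered from below only at the lower corners of the square of level `D`, which
    -- `none` excludes.
    ... | no ¬z | yes ((gt , le) , e) = ⊥-elim (below (row (v ⊕ t)) gt le e)
      where
      below : ∀ i → D < i → i ≤ M → v ⊕ t ≡ pt i D ⊎ v ⊕ t ≡ pt i (1 + D) → ⊥
      below (suc i) (s≤s D≤i) le e with D ≟ᴺ i
      ... | no D≢i = [ (λ e → ¬z (subst Z (sym (entering-Z D (s≤s D≤i) e)) (Z-D (≤∧≢⇒< D≤i D≢i) (<⇒≤ le)))) ,
                       (λ e → ¬z (subst Z (sym (entering-Z (1 + D) (s≤s D≤i) e)) (Z-1+D (≤∧≢⇒< D≤i D≢i) (<⇒≤ le)))) ]′ e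
      ... | yes refl = [ (λ e → proj₁ (none D ≤-refl) (trans (entering-Z D (s≤s D≤i) e) (sym (q-low ≤-refl)))) ,
                         (λ e → proj₂ (none D ≤-refl) (trans (entering-Z (1 + D) (s≤s D≤i) e)
                            (sym (trans (cong (_⊕ s) (q-low ≤-refl)) (pt-s D D))))) ]′ e

    low-f̃ : ∀ i → i ≤ D → f̃ (q i) ≡ f̃ (q i ⊕ s)
    low-f̃ i i≤D = trans (f̃-¬Z (low⇒¬Z (≤-trans (≤-reflexive (row-q i≤M)) i≤D)))
      (trans (sym (inv (T.edge-t (Q-q i≤M)))) (sym (f̃-¬Z (low⇒¬Z (≤-trans (≤-reflexive (row-q-s i≤M)) i≤D)))))
      where
      i≤M : i ≤ M
      i≤M = ≤-trans i≤D D≤M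

    high-f̃ : ∀ i → i ≤ D → f̃ (q i ⊕ t) ≡ f̃ (q i ⊕ s ⊕ t)
    high-f̃ i i≤D = trans (cong f̃ (trans (cong (_⊕ t) (q-low i≤D)) (pt-t i i)))
      (trans same (sym (cong f̃ (trans (cong (λ u → u ⊕ s ⊕ t) (q-low i≤D)) (trans (cong (_⊕ t) (pt-s i i)) (pt-t i (suc i)))))))
      where
      horizontal : f (pt (suc i) i) ≡ f (pt (suc i) (suc i))
      horizontal = sym (inv (top (≤-trans i≤D D≤M) (J-low i≤D)))
      same-outside : ¬ Z (pt (suc i) i) → ¬ Z (pt (suc i) (suc i)) → f̃ (pt (suc i) i) ≡ f̃ (pt (suc i) (suc i))
      same-outside ¬z ¬z′ = trans (f̃-¬Z ¬z) (trans horizontal (sym (f̃-¬Z ¬z′)))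
      same : f̃ (pt (suc i) i) ≡ f̃ (pt (suc i) (suc i))
      same with i ≟ᴺ D | suc i ≤? M
      ... | yes refl | yes i<M = trans (f̃-Z (Z-D ≤-refl i<M)) (sym (f̃-Z (Z-1+D ≤-refl i<M)))
      ... | yes refl | no  i≮M = same-outside (empty ∘ proj₁) (empty ∘ proj₁)
        where
        empty : ∀ {j} → ¬ (D < j × j ≤ M)
        empty (gt , le) = i≮M (≤-trans gt le)
      ... | no i≢D | _ = same-outside (low⇒¬Z (≤-trans (≤-reflexive (row-pt i 1+i<R)) i<D)) (low⇒¬Z (≤-trans (≤-reflexive (row-pt (suc i) 1+i<R)) i<D))
        where
        i<D : i < D
        i<D = ≤∧≢⇒< i≤D i≢D
        1+i<R : suc i < R
        1+i<R = ≤-<-trans (≤-trans i<D D≤M) M<R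

    f̃-constant : ∀ u v → f̃ u ≡ f̃ v
    f̃-constant = Col.Staircase.constant f̃ q (λ i → q i ⊕ s) D inv-f̃ low-f̃ high-f̃
      (λ i i≤D → trans (cong col (q-low i≤D)) (col-pt i (≤-<-trans i≤D D<C)))
      (λ i i<D → trans (col-y (<⇒≤ i<D)) (col-pt i (≤-<-trans i<D D<C)))
      (Data.Sum.map
        (λ e → trans (col-y ≤-refl) (col-pt D (≤-reflexive (sym (proj₁ (proj₂ e))))) , proj₁ (proj₂ e))
        (λ e → trans (col-y ≤-refl) (trans (cong (col ∘ pt D) (sym (proj₂ e))) (col-pt-C D)) , proj₂ e , D-even)
        mode)
      where
      col-y : ∀ {i} → i ≤ D → col (q i ⊕ s) ≡ col (pt i (suc i))
      col-y {i} i≤D = cong col (trans (cong (_⊕ s) (q-low i≤D)) (pt-s i i))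

    -- Overwriting loses nothing: every row of `Z` is joined by horizontal edges to column `D + 2`,
    -- where `f` was kept.
    outside-Z : ∀ v → ∃ λ w → ¬ Z w × f v ≡ f w
    outside-Z v with Z? v
    ... | no ¬z = v , ¬z , refl
    ... | yes ((gt , le) , e) with split (row v)
    ...   | inj₁ le′ = contradiction (<-≤-trans gt le′) (<-irrefl refl)
    ...   | inj₂ (k , r) rewrite r = pt (D + suc k) (2 + D) , outside ,
              [ (λ e → trans (cong f e) (proj₁ (snake k le))) , (λ e → trans (cong f e) (proj₂ (snake k le))) ]′ e
      where
      row-w : row (pt (D + suc k) (2 + D)) ≡ D + suc k
      row-w = row-pt (2 + D) (≤-<-trans le M<R)
      outside : ¬ Z (pt (D + suc k) (2 + D))
      outside (_ , inj₁ e) = pt-2+≢ (D + suc k) D (sym (trans e (cong (λ z → pt z D) row-w)))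
      outside (_ , inj₂ e) = pt-suc≢ (D + suc k) (1 + D) (sym (trans e (cong (λ z → pt z (1 + D)) row-w)))

  T-connected : InvariantsConstant T.E
  T-connected f inv u v =
    let (u′ , ¬zu , eu) = outside-Z u
        (v′ , ¬zv , ev) = outside-Z v
    in trans eu (trans (sym (f̃-¬Z ¬zu)) (trans (f̃-constant u′ v′) (trans (f̃-¬Z ¬zv) (sym ev))))
    where open Straighten f inv

  -- Parities of the positions along the two cycles

  private
    ⊞-cancel-⁻¹ : ∀ p {a b} → p ⊞ a ≡ (p ⊞ b) ⁻¹ → a ≡ b ⁻¹
    ⊞-cancel-⁻¹ 0ℙ e = e
    ⊞-cancel-⁻¹ 1ℙ e = ⁻¹-injective e

    ⊞-cancelʳ : ∀ a {p q} → p ⊞ a ≡ q ⊞ a → p ≡ q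
    ⊞-cancelʳ a {p} {q} e = ℙ.+-cancelʳ-≡ a p q e

    alternating : ∀ (x : ℕ → Parity) m → (∀ j → j < m → x (suc j) ≡ x j ⁻¹) → x m ≡ parity m ⊞ x 0
    alternating x zero    _  = refl
    alternating x (suc m) ok = begin
      x (suc m)               ≡⟨ ok m (n<1+n m) ⟩
      x m ⁻¹                  ≡⟨ cong _⁻¹ (alternating x m (λ j j<m → ok j (m<n⇒m<1+n j<m))) ⟩
      1ℙ ⊞ (parity m ⊞ x 0)   ≡⟨ sym (ℙ.+-assoc 1ℙ (parity m) (x 0)) ⟩
      (parity m ⁻¹) ⊞ x 0     ≡⟨ cong (_⊞ x 0) (sym (parity-suc m)) ⟩
      parity (suc m) ⊞ x 0    ∎
      where open ≡-Reasoning

    odd-factor : ∀ a b → a * b ≡ n → parity b ≡ 1ℙ → parity a ≡ 0ℙ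
    odd-factor a b ab≡n odd = trans (sym (ℙ.*-identityʳ (parity a)))
      (trans (cong (parity a ⊠_) (sym odd)) (trans (sym (*-homo-* a b)) (trans (cong parity ab≡n) n-even)))

  module T-Parity (c₂ : V → Parity) (T-flips : ∀ {u v} → T.E u v → c₂ v ≡ c₂ u ⁻¹) where

    FlipAt : V → Set
    FlipAt v = c₂ (v ⊕ t) ≡ c₂ v ⁻¹

    Flip : ℕ → Set
    Flip i = FlipAt (q i)

    flip-right : ∀ {i} → i ≤ M → Flip i → c₂ (q i ⊕ s ⊕ t) ≡ c₂ (q i ⊕ s) ⁻¹
    flip-right {i} i≤M ok = begin
      c₂ (q i ⊕ s ⊕ t)   ≡⟨ cong c₂ (⊕-comm (q i) s t) ⟩
      c₂ (q i ⊕ t ⊕ s)   ≡⟨ T-flips (T.edge-t′ (Q-q i≤M)) ⟩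
      c₂ (q i ⊕ t) ⁻¹    ≡⟨ cong _⁻¹ ok ⟩
      (c₂ (q i) ⁻¹) ⁻¹   ≡⟨ cong _⁻¹ (sym (T-flips (T.edge-t (Q-q i≤M)))) ⟩
      c₂ (q i ⊕ s) ⁻¹    ∎
      where open ≡-Reasoning

    twice : ∀ {u v w} → T.E u v → T.E v w → c₂ w ≡ c₂ u
    twice a b = trans (T-flips b) (trans (cong _⁻¹ (T-flips a)) (⁻¹-involutive _))

    -- Three edges of the class lead from `q i` to `q i ⊕ t` by way of column `D`. At even height,
    -- in `flip-even`, five edges do so by way of column `D + 2`.
    flip-odd : ∀ k → parity (suc k) ≡ 1ℙ → D + suc k < M → Flip (D + suc k)
    flip-odd k odd i<M = begin
      c₂ (q i ⊕ t)              ≡⟨ cong c₂ (trans (cong (λ j → pt i j ⊕ t) (J-odd (suc k) odd)) (pt-t _ _)) ⟩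
      c₂ (pt (suc i) (1 + D))   ≡⟨ T-flips (proj₁ (zig-row-suc k i<M)) ⟩
      c₂ (pt (suc i) D) ⁻¹      ≡⟨ cong _⁻¹ (T-flips (zig-column-D k odd (<⇒≤ i<M))) ⟩
      (c₂ (pt i D) ⁻¹) ⁻¹       ≡⟨ cong _⁻¹ (sym (T-flips (proj₁ (zig-row k (<⇒≤ i<M))))) ⟩
      c₂ (pt i (1 + D)) ⁻¹      ≡⟨ cong (λ j → c₂ (pt i j) ⁻¹) (sym (J-odd (suc k) odd)) ⟩
      c₂ (q i) ⁻¹               ∎
      where
      open ≡-Reasoning
      i : ℕ
      i = D + suc k

    flip-even : ∀ k → parity (suc k) ≡ 0ℙ → D + suc k < M → Flip (D + suc k)
    flip-even k even i<M = begin
      c₂ (q i ⊕ t)              ≡⟨ cong c₂ (trans (cong (λ j → pt i j ⊕ t) (J-even (suc k) even)) (pt-t _ _)) ⟩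
      c₂ (pt (suc i) D)         ≡⟨ sym (twice (proj₁ (zig-row-suc k i<M)) (proj₂ (zig-row-suc k i<M))) ⟩
      c₂ (pt (suc i) (2 + D))   ≡⟨ T-flips (zig-column-2+D k even (<⇒≤ i<M)) ⟩
      c₂ (pt i (2 + D)) ⁻¹      ≡⟨ cong _⁻¹ (twice (proj₁ (zig-row k (<⇒≤ i<M))) (proj₂ (zig-row k (<⇒≤ i<M)))) ⟩
      c₂ (pt i D) ⁻¹            ≡⟨ cong (λ j → c₂ (pt i j) ⁻¹) (sym (J-even (suc k) even)) ⟩
      c₂ (q i) ⁻¹               ∎
      where
      open ≡-Reasoning
      i : ℕ
      i = D + suc k

    flip-zig : ∀ k → D + suc k < M → Flip (D + suc k)
    flip-zig k i<M = [ (λ even → flip-even k even i<M) , (λ odd → flip-odd k odd i<M) ]′ (even-or-odd (suc k))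

    col-q : ∀ {i} → i ≤ D → col (q i) ≡ i
    col-q i≤D = trans (cong col (q-low i≤D)) (col-pt _ (≤-<-trans i≤D D<C))

    col-q-s : ∀ {i} → i ≤ D → col (q i ⊕ s) ≡ suc i ⊎ (C ≡ 1 + D × col (q i ⊕ s) ≡ 0)
    col-q-s {i} i≤D with suc i <? C
    ... | yes 1+i<C = inj₁ (trans (cong col (trans (cong (_⊕ s) (q-low i≤D)) (pt-s i i))) (col-pt i 1+i<C))
    ... | no  1+i≮C = inj₂ (trans (sym 1+i≡C) (cong suc i≡D) ,
          trans (cong col (trans (cong (_⊕ s) (q-low i≤D)) (trans (pt-s i i) (cong (pt i) 1+i≡C)))) (col-pt-C i))
      where
      1+i≡C : suc i ≡ C
      1+i≡C = ≤-antisym (≤-<-trans i≤D D<C) (≮⇒≥ 1+i≮C)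
      i≡D : i ≡ D
      i≡D = ≤-antisym i≤D (m<1+n⇒m≤n (≤-trans D<C (≤-reflexive (sym 1+i≡C))))

    -- A full turn through the columns takes `C` squares. For `C = 2 + D` the missing one in column
    -- `D + 1` is the first square of the zigzag.
    diagonal : ∀ {i} → i < C → i ≤ M × q i ≡ pt i i
    diagonal {i} i<C with split i
    ... | inj₁ i≤D = ≤-trans i≤D D≤M , q-low i≤D
    ... | inj₂ (k , refl) = case mode of λ
      { (inj₂ (_ , C≡)) → contradiction (≤-trans (s≤s (≤-trans (s≤s (m≤m+n D k)) (≤-reflexive (sym (+-suc D k))))) (≤-trans i<C (≤-reflexive C≡))) (<-irrefl refl)
      ; (inj₁ (_ , C≡ , 0<K)) → first 0<K (n≤0⇒n≡0 (+-cancelˡ-≤ D k 0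
          (≤-trans (≤-pred (≤-pred (subst (_≤ 2 + D) (cong suc (+-suc D k)) (≤-trans i<C (≤-reflexive C≡))))) (≤-reflexive (sym (+-identityʳ D)))))) }
      where
      first : 0 < K → k ≡ 0 → D + suc k ≤ M × q (D + suc k) ≡ pt (D + suc k) (D + suc k)
      first 0<K refl = +-monoʳ-≤ D 0<K , cong (pt (D + 1)) (J-zig 1)

    module AllFlip (first : Flip 0) (last : Flip M) where

      flip-outside : ∀ v → (∀ i → 1 ≤ i → i ≤ D → v ≢ q i × v ≢ q i ⊕ s) → c₂ (v ⊕ t) ≡ c₂ v ⁻¹
      flip-outside v none with anyUpTo? (λ i → (v ≟ q i) ⊎-dec (v ≟ q i ⊕ s)) (suc M)
      ... | no none′ = T-flips (T-step v λ i le → (λ e → none′ (i , s≤s le , inj₁ e)) , (λ e → none′ (i , s≤s le , inj₂ e)))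
      ... | yes (i , s≤s i≤M , e) =
          [ (λ v≡ → subst FlipAt (sym v≡) (known i i≤M e)) , (λ v≡ → subst FlipAt (sym v≡) (flip-right i≤M (known i i≤M e))) ]′ e
        where
        known : ∀ i → i ≤ M → v ≡ q i ⊎ v ≡ q i ⊕ s → Flip i
        known zero _ _ = first
        known (suc i) i≤M e with split (suc i)
        ... | inj₁ i≤D = ⊥-elim ([ proj₁ (none (suc i) (s≤s z≤n) i≤D) , proj₂ (none (suc i) (s≤s z≤n) i≤D) ]′ e)
        ... | inj₂ (k , eq) with suc i ≟ᴺ M
        ...   | yes 1+i≡M = subst Flip (sym 1+i≡M) last
        ...   | no  i≢M = subst Flip (sym eq) (flip-zig k (subst (_< M) eq (≤∧≢⇒< i≤M i≢M)))

      -- Either `C` is odd, and the order inherits the evenness of `n`; or no square of level 1 to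
      -- `D` touches column 0, and `c₂` alternates all the way around it.
      col-order-even : parity col-order ≡ 0ℙ
      col-order-even = case mode of λ
        { (inj₂ (_ , C≡)) → odd-factor col-order C col-order*C (trans (cong parity C≡) (even⇒suc-odd D D-even))
        ; (inj₁ (_ , C≡ , _)) → Col.flips⇒even-order c₂ (q 0) λ v kv → flip-outside v λ i 1≤i i≤D →
            (λ { refl → <-irrefl (sym (trans (sym (col-q i≤D)) (trans kv (col-q z≤n)))) 1≤i }) ,
            (λ { refl → case col-q-s i≤D of λ
              { (inj₁ e) → 1+n≢0 (trans (sym e) (trans kv (col-q z≤n)))
              ; (inj₂ (C≡′ , _)) → 1+n≢n (suc-injective (trans (sym C≡) C≡′)) } }) }

      -- In the coset of `q (suc k)` only that vertex is still in doubt once square `k` flips, and a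
      -- colouring of a cycle of even length cannot fail to alternate at just one edge.
      flip-x : ∀ k → k ≤ D → Flip k
      flip-x zero    _   = first
      flip-x (suc k) k<D = Col.even-order-exception col-order-even c₂ (q (suc k)) λ v kv v≢x →
        let kv′ = trans kv (col-q k<D) in case v ≟ q k ⊕ s of λ
        { (yes v≡y) → subst FlipAt (sym v≡y) (flip-right (≤-trans (<⇒≤ k<D) D≤M) (flip-x k (<⇒≤ k<D)))
        ; (no v≢y) → flip-outside v λ i _ i≤D →
            (λ v≡ → v≢x (trans v≡ (cong q (trans (sym (col-q i≤D)) (trans (cong col (sym v≡)) kv′))))) ,
            (λ v≡ → case col-q-s i≤D of λ
              { (inj₁ e) → v≢y (trans v≡ (cong (λ z → q z ⊕ s) (suc-injective (trans (sym e) (trans (cong col (sym v≡)) kv′)))))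
              ; (inj₂ (_ , e)) → 0≢1+n (trans (sym e) (trans (cong col (sym v≡)) kv′)) }) }

      flip-all : ∀ v → c₂ (v ⊕ t) ≡ c₂ v ⁻¹
      flip-all v with anyUpTo? (λ i → (v ≟ q i) ⊎-dec (v ≟ q i ⊕ s)) (suc D)
      ... | no none = flip-outside v λ i _ le → (λ e → none (i , s≤s le , inj₁ e)) , (λ e → none (i , s≤s le , inj₂ e))
      ... | yes (i , s≤s i≤D , inj₁ refl) = flip-x i i≤D
      ... | yes (i , s≤s i≤D , inj₂ refl) = flip-right (≤-trans i≤D D≤M) (flip-x i i≤D)

      column : ∀ i j → c₂ (pt i j) ≡ parity i ⊞ c₂ (pt 0 j)
      column i j = trans (cong c₂ (sym (pt-m*t i j))) (Col.walk-flip c₂ (pt 0 j) i (λ k _ → flip-all _))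

      -- The bottom edge of the diagonal square of level `i` lies in row `i`; as every vertical edge
      -- flips, its flip can be moved down to row 0.
      along-row : c₂ (pt 0 C) ≡ parity C ⊞ c₂ (pt 0 0)
      along-row = alternating (λ j → c₂ (pt 0 j)) C λ i i<C → let (i≤M , q≡) = diagonal i<C in
        ⊞-cancel-⁻¹ (parity i) (begin
          parity i ⊞ c₂ (pt 0 (suc i))   ≡⟨ sym (column i (suc i)) ⟩
          c₂ (pt i (suc i))              ≡⟨ cong c₂ (sym (trans (cong (_⊕ s) q≡) (pt-s i i))) ⟩
          c₂ (q i ⊕ s)                   ≡⟨ T-flips (T.edge-t (Q-q i≤M)) ⟩
          c₂ (q i) ⁻¹                    ≡⟨ cong (λ v → c₂ v ⁻¹) q≡ ⟩
          c₂ (pt i i) ⁻¹                 ≡⟨ cong _⁻¹ (column i i) ⟩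
          (parity i ⊞ c₂ (pt 0 i)) ⁻¹    ∎)
        where open ≡-Reasoning

      -- The vertex `pt 0 C` is also some `pt l 0`. Reaching it along the row and along the column
      -- gives `C` and `l` the same parity.
      impossible : (∀ l → parity col-order ≡ 0ℙ → (C * s) ≈ (l * t) mod n → parity C ≢ parity l) → ⊥
      impossible twist = let (l , e) = col-reach (pt 0 0) (pt 0 C) (trans (col-pt 0 (≤-<-trans z≤n D<C)) (sym (col-pt-C 0))) in
        twist l col-order-even
          (≈-trans (pt-injective (trans e (pt-m*t l 0))) (≈-reflexive (+-identityʳ (l * t))))
          (⊞-cancelʳ (c₂ (pt 0 0)) (trans (sym along-row) (trans (cong c₂ (trans e (pt-m*t l 0))) (column l 0))))

    no-flip : (∀ l → parity col-order ≡ 0ℙ → (C * s) ≈ (l * t) mod n → parity C ≢ parity l) →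
      c₂ (q 0 ⊕ t) ≡ c₂ (q 0) ⊎ c₂ (q M ⊕ t) ≡ c₂ (q M)
    no-flip twist with c₂ (q 0 ⊕ t) ≟ℙ c₂ (q 0) | c₂ (q M ⊕ t) ≟ℙ c₂ (q M)
    ... | yes e | _     = inj₁ e
    ... | _     | yes e = inj₂ e
    ... | no ¬e | no ¬e′ = ⊥-elim (AllFlip.impossible (≢⇒⁻¹ ¬e) (≢⇒⁻¹ ¬e′) twist)

  module S-Parity (c₁ : V → Parity) (S-flips : ∀ {u v} → S.E u v → c₁ v ≡ c₁ u ⁻¹) where

    FlipAt : V → Set
    FlipAt v = c₁ (v ⊕ s) ≡ c₁ v ⁻¹

    Flip : ℕ → Set
    Flip i = FlipAt (q i)

    flip-above : ∀ {i} → i ≤ M → Flip i → FlipAt (q i ⊕ t)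
    flip-above {i} i≤M ok = begin
      c₁ (q i ⊕ t ⊕ s)   ≡⟨ cong c₁ (⊕-comm (q i) t s) ⟩
      c₁ (q i ⊕ s ⊕ t)   ≡⟨ S-flips (S.edge-t′ (Q-q i≤M)) ⟩
      c₁ (q i ⊕ s) ⁻¹    ≡⟨ cong _⁻¹ ok ⟩
      (c₁ (q i) ⁻¹) ⁻¹   ≡⟨ cong _⁻¹ (sym (S-flips (S.edge-t (Q-q i≤M)))) ⟩
      c₁ (q i ⊕ t) ⁻¹    ∎
      where open ≡-Reasoning

    same-below : ∀ {i} → i ≤ M → c₁ (q i ⊕ t ⊕ s) ≡ c₁ (q i ⊕ t) → c₁ (q i ⊕ s) ≡ c₁ (q i)
    same-below {i} i≤M same = ⁻¹-injective (begin
      c₁ (q i ⊕ s) ⁻¹    ≡⟨ sym (S-flips (S.edge-t′ (Q-q i≤M))) ⟩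
      c₁ (q i ⊕ s ⊕ t)   ≡⟨ cong c₁ (⊕-comm (q i) s t) ⟩
      c₁ (q i ⊕ t ⊕ s)   ≡⟨ same ⟩
      c₁ (q i ⊕ t)       ≡⟨ S-flips (S.edge-t (Q-q i≤M)) ⟩
      c₁ (q i) ⁻¹        ∎)
      where open ≡-Reasoning

    classify : ∀ v → FlipAt v ⊎ ∃ λ i → i ≤ M × (v ≡ q i ⊎ v ≡ q i ⊕ t)
    classify v with anyUpTo? (λ i → (v ≟ q i) ⊎-dec (v ≟ q i ⊕ t)) (suc M)
    ... | no none = inj₁ (S-flips (S-step v λ i le → (λ e → none (i , s≤s le , inj₁ e)) , (λ e → none (i , s≤s le , inj₂ e))))
    ... | yes (i , s≤s i≤M , e) = inj₂ (i , i≤M , e)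

    row-q-t : ∀ {i} → i ≤ M → row (q i ⊕ t) ≡ suc i ⊎ (row (q i ⊕ t) ≡ 0 × R ≡ suc i)
    row-q-t {i} i≤M with suc i <? R
    ... | yes 1+i<R = inj₁ (trans (cong row (pt-t i (J i))) (row-pt _ 1+i<R))
    ... | no  1+i≮R = let R≡ = ≤-antisym (≮⇒≥ 1+i≮R) (≤-<-trans i≤M M<R) in
      inj₂ (trans (cong row (trans (pt-t i (J i)) (cong (λ z → pt z (J i)) (sym R≡)))) (row-pt-R _) , R≡)

    flip-suc : parity row-order ≡ 0ℙ → ∀ {i} → suc i ≤ M → Flip i → Flip (suc i)
    flip-suc even {i} i<M ok = Row.even-order-exception even c₁ (q (suc i)) λ v kv v≢x → case classify v of λ
      { (inj₁ flip) → flip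
      ; (inj₂ (k , k≤M , inj₁ v≡)) → contradiction (trans v≡ (cong q
          (trans (sym (row-q k≤M)) (trans (cong row (sym v≡)) (trans kv (row-q i<M)))))) v≢x
      ; (inj₂ (k , k≤M , inj₂ v≡)) → let kv′ = trans (cong row (sym v≡)) (trans kv (row-q i<M)) in case row-q-t k≤M of λ
          { (inj₁ e) → subst FlipAt (sym v≡) (flip-above k≤M (subst Flip (suc-injective (trans (sym kv′) e)) ok))
          ; (inj₂ (e , _)) → contradiction (trans (sym e) kv′) 0≢1+n } }

    flip-upto : parity row-order ≡ 0ℙ → Flip 0 → ∀ i → i ≤ M → Flip i
    flip-upto even first zero    _   = first
    flip-upto even first (suc i) i<M = flip-suc even i<M (flip-upto even first i (<⇒≤ i<M))

    module AllFlip (flips : ∀ i → i ≤ M → Flip i) where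

      flip-all : ∀ v → FlipAt v
      flip-all v = case classify v of λ
        { (inj₁ flip) → flip
        ; (inj₂ (i , i≤M , inj₁ v≡)) → subst FlipAt (sym v≡) (flips i i≤M)
        ; (inj₂ (i , i≤M , inj₂ v≡)) → subst FlipAt (sym v≡) (flip-above i≤M (flips i i≤M)) }

      along-row : ∀ i j → c₁ (pt i j) ≡ parity j ⊞ c₁ (pt i 0)
      along-row i j = trans (cong c₁ (sym (pt-m*s i j))) (Row.walk-flip c₁ (pt i 0) j (λ k _ → flip-all _))

      upward : ∀ i → i ≤ suc M → c₁ (pt i 0) ≡ parity i ⊞ c₁ (pt 0 0)
      upward m m≤ = alternating (λ i → c₁ (pt i 0)) m λ i i<m → ⊞-cancel-⁻¹ (parity (J i)) (begin
        parity (J i) ⊞ c₁ (pt (suc i) 0)   ≡⟨ sym (along-row (suc i) (J i)) ⟩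
        c₁ (pt (suc i) (J i))              ≡⟨ cong c₁ (sym (pt-t i (J i))) ⟩
        c₁ (q i ⊕ t)                       ≡⟨ S-flips (S.edge-t (Q-q (m<1+n⇒m≤n (≤-trans i<m m≤)))) ⟩
        c₁ (q i) ⁻¹                        ≡⟨ cong _⁻¹ (along-row i (J i)) ⟩
        (parity (J i) ⊞ c₁ (pt i 0)) ⁻¹    ∎)
        where open ≡-Reasoning

      wrap : ∃ λ l → (R * t) ≈ (l * s) mod n × c₁ (pt R 0) ≡ parity l ⊞ c₁ (pt 0 0)
      wrap = let (l , e) = row-reach (pt 0 0) (pt R 0) (trans (row-pt 0 (≤-<-trans z≤n M<R)) (sym (row-pt-R 0))) in
        l , ≈-trans (≈-reflexive (sym (+-identityʳ (R * t)))) (pt-injective (trans e (pt-m*s 0 l))) ,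
        trans (cong c₁ (trans e (pt-m*s 0 l))) (along-row 0 l)

    -- The first and the last square share row 0, so a flip at either of them spreads to all rows.
    -- Going once around the rows then gives `R` the parity of the shift `l`, against `twist`.
    closed : R ≡ 1 + M → (∀ l → (R * t) ≈ (l * s) mod n → parity R ≢ parity l) →
      c₁ (q 0 ⊕ s) ≡ c₁ (q 0) × c₁ (q M ⊕ s) ≡ c₁ (q M)
    closed R≡ twist = stable 0 impossible , stable M (λ ok → impossible (last⇒first ok))
      where
      row-order-even : parity row-order ≡ 0ℙ
      row-order-even = odd-factor row-order R row-order*R (trans (cong parity R≡) (even⇒suc-odd M M-even))

      impossible : ¬ Flip 0
      impossible first = let (l , R*t≈ , e) = wrap in twist l R*t≈
        (⊞-cancelʳ (c₁ (pt 0 0)) (trans (sym (upward R (≤-reflexive R≡))) e))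
        where open AllFlip (flip-upto row-order-even first)

      last⇒first : Flip M → Flip 0
      last⇒first ok = Row.even-order-exception row-order-even c₁ (q 0) λ v kv v≢x → case classify v of λ
        { (inj₁ flip) → flip
        ; (inj₂ (k , k≤M , inj₁ v≡)) → contradiction (trans v≡ (cong q
            (trans (sym (row-q k≤M)) (trans (cong row (sym v≡)) (trans kv (row-q z≤n)))))) v≢x
        ; (inj₂ (k , k≤M , inj₂ v≡)) → let kv′ = trans (cong row (sym v≡)) (trans kv (row-q z≤n)) in case row-q-t k≤M of λ
            { (inj₁ e) → contradiction (trans (sym e) kv′) 1+n≢0
            ; (inj₂ (_ , R≡′)) → subst FlipAt (sym v≡) (flip-above k≤M (subst Flip (suc-injective (trans (sym R≡) R≡′)) ok)) } }

      stable : ∀ i → ¬ Flip i → c₁ (q i ⊕ s) ≡ c₁ (q i)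
      stable i ¬flip with c₁ (q i ⊕ s) ≟ℙ c₁ (q i)
      ... | yes e = e
      ... | no ¬e = contradiction (≢⇒⁻¹ ¬e) ¬flip

    module Open (R≡ : R ≡ 2 + M) where

      bottom-row : ∀ v → row v ≡ row (q 0) → v ≢ q 0 → FlipAt v
      bottom-row v kv v≢x = case classify v of λ
        { (inj₁ flip) → flip
        ; (inj₂ (k , k≤M , inj₁ v≡)) → contradiction (trans v≡ (cong q
            (trans (sym (row-q k≤M)) (trans (cong row (sym v≡)) (trans kv (row-q z≤n)))))) v≢x
        ; (inj₂ (k , k≤M , inj₂ v≡)) → let kv′ = trans (cong row (sym v≡)) (trans kv (row-q z≤n)) in case row-q-t k≤M of λ
            { (inj₁ e) → contradiction (trans (sym e) kv′) 1+n≢0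
            ; (inj₂ (_ , R≡′)) → contradiction (≤-trans (≤-reflexive (suc-injective (trans (sym R≡) R≡′))) k≤M) (<-irrefl refl) } }

      row-top : row (q M ⊕ t) ≡ suc M
      row-top = trans (cong row (pt-t M (J M))) (row-pt _ (≤-reflexive (sym R≡)))

      top-row : ∀ v → row v ≡ row (q M ⊕ t) → v ≢ q M ⊕ t → FlipAt v
      top-row v kv v≢x = case classify v of λ
        { (inj₁ flip) → flip
        ; (inj₂ (k , k≤M , inj₁ v≡)) → contradiction
            (≤-trans (≤-reflexive (trans (sym row-top) (trans (sym kv) (trans (cong row v≡) (row-q k≤M))))) k≤M) (<-irrefl refl)
        ; (inj₂ (k , k≤M , inj₂ v≡)) → let kv′ = trans (cong row (sym v≡)) (trans kv row-top) in case row-q-t k≤M of λ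
            { (inj₁ e) → contradiction (trans v≡ (cong (λ z → q z ⊕ t) (suc-injective (trans (sym e) kv′)))) v≢x
            ; (inj₂ (e , _)) → contradiction (trans (sym e) kv′) 0≢1+n } }

      -- The lowest and the highest row have one broken edge each. Around an odd cycle the colours
      -- alternate elsewhere, so they must agree across that edge.
      odd-rows : parity row-order ≡ 1ℙ → c₁ (q 0 ⊕ s) ≡ c₁ (q 0) × c₁ (q M ⊕ s) ≡ c₁ (q M)
      odd-rows odd = Row.odd-order-exception odd c₁ (q 0) bottom-row ,
        same-below ≤-refl (Row.odd-order-exception odd c₁ (q M ⊕ t) top-row)

      module EvenRows (even : parity row-order ≡ 0ℙ) (twist : ∀ l → (R * t) ≈ (l * s) mod n → parity l ≡ 1ℙ) where
        open AllFlip (flip-upto even (Row.even-order-exception even c₁ (q 0) bottom-row)) public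

        -- Row `R` is row 0 shifted by an odd `l`, and `suc M` is odd as well, so the chessboard
        -- repeats across the gap instead of alternating.
        same-over-top : ∀ j → c₁ (pt R j) ≡ c₁ (pt (suc M) j)
        same-over-top j = trans (along-row R j) (trans (cong (parity j ⊞_) zeroth) (sym (along-row (suc M) j)))
          where
          zeroth : c₁ (pt R 0) ≡ c₁ (pt (suc M) 0)
          zeroth = let (l , R*t≈ , e) = wrap in trans e (trans (cong (_⊞ c₁ (pt 0 0))
            (trans (twist l R*t≈) (sym (even⇒suc-odd M M-even)))) (sym (upward (suc M) ≤-refl)))

    module TopSquare (R≡ : R ≡ 2 + M) (even : parity row-order ≡ 0ℙ) (long : 4 + D ≤ row-order)
      (twist : ∀ l → (R * t) ≈ (l * s) mod n → parity l ≡ 1ℙ)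
      (c₂ : V → Parity) (T-flips : ∀ {u v} → T.E u v → c₂ v ≡ c₂ u ⁻¹) where

      open Open R≡ using (module EvenRows)
      open EvenRows even twist

      1+M<R : suc M < R
      1+M<R = ≤-reflexive (sym R≡)

      over-top : ∀ v → row v ≡ suc M → T.E v (v ⊕ t)
      over-top v r = T-step v λ i i≤M →
        (λ v≡ → too-high i≤M (trans (sym r) (trans (cong row v≡) (row-q i≤M)))) ,
        (λ v≡ → too-high i≤M (trans (sym r) (trans (cong row v≡) (row-q-s i≤M))))
        where
        too-high : ∀ {i} → i ≤ M → suc M ≡ i → ⊥
        too-high i≤M e = <-irrefl refl (≤-trans (≤-reflexive e) i≤M)

      private
        -- Squares reach at most to column `D + 2`, so `D + 3` is the first free column; row length
        -- at least `D + 4` keeps it from wrapping onto the others.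
        column≢ : ∀ i {j} → j ≤ 2 + D → pt i (3 + D) ≢ pt i j
        column≢ i {j} j≤ e = <-irrefl refl (<-≤-trans long (≤-trans
            (∣⇒≤ (row-order∣ gap≈0)) (s≤s (≤-trans (m≤n+m k j) (≤-reflexive k-eq)))))
          where
          k : ℕ
          k = 2 + D ∸ j
          k-eq : j + k ≡ 2 + D
          k-eq = m+[n∸m]≡n j≤
          open ≡-Reasoning
          gap≈0 : (suc k * s) ≈ 0 mod n
          gap≈0 = ≈-cancel (i * t + j * s) (i * t + j * s)
            (≈-trans (≈-reflexive (begin
               suc k * s + (i * t + j * s)   ≡⟨ collect (suc k) s (i * t) j ⟩
               i * t + (j + suc k) * s       ≡⟨ cong (λ z → i * t + z * s) (trans (+-suc j k) (cong suc k-eq)) ⟩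
               i * t + (3 + D) * s           ∎)) (pt-injective e)) ≈-refl
            where
            collect : ∀ k s x j → k * s + (x + j * s) ≡ x + (j + k) * s
            collect = solve-∀

      unbroken-column : c₂ (pt (suc M) (3 + D)) ≡ parity (suc M) ⊞ c₂ (pt 0 (3 + D))
      unbroken-column = alternating (λ i → c₂ (pt i (3 + D))) (suc M) λ i i<1+M → T-flips (T-vertical (3 + D) (m<1+n⇒m≤n i<1+M)
        (column≢ i (≤-trans (J≤1+D i) (n≤1+n _)))
        (λ e → column≢ i (s≤s (J≤1+D i)) (trans e (pt-s i (J i)))))

      -- Otherwise `c₂` alternates along the whole top row. Write the foot of column `D + 3` as
      -- `pt R j`: the chessboard `c₁` and the alternation of `c₂` up this column demand opposite
      -- parities of `j`.
      square : ∃ λ v → row v ≡ suc M × c₂ (v ⊕ s) ≡ c₂ v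
      square with any? (λ v → (row v ≟ᴺ suc M) ×-dec (c₂ (v ⊕ s) ≟ℙ c₂ v))
      ... | yes found = found
      ... | no none = ⊥-elim (clash (parity j) (trans (sym c₂-parities) c₁-parities))
        where
        open ≡-Reasoning
        top-row : ∀ j → c₂ (pt (suc M) j) ≡ parity j ⊞ c₂ (pt (suc M) 0)
        top-row j = trans (cong c₂ (sym (pt-m*s (suc M) j))) (Row.walk-flip c₂ (pt (suc M) 0) j λ k _ →
          ≢⇒⁻¹ λ e → none (_ , trans (Row.kind-m*g (pt (suc M) 0) k) (row-pt 0 1+M<R) , e))
        returns : ∃ λ j → pt 0 (3 + D) ≡ pt R 0 ⊕ j * s
        returns = row-reach (pt R 0) (pt 0 (3 + D)) (trans (row-pt-R 0) (sym (row-pt _ (≤-<-trans z≤n M<R))))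
        j : ℕ
        j = proj₁ returns
        at-j : pt 0 (3 + D) ≡ pt R j
        at-j = trans (proj₂ returns) (pt-m*s R j)
        1+M-odd : parity (suc M) ≡ 1ℙ
        1+M-odd = even⇒suc-odd M M-even
        c₁-parities : parity (3 + D) ≡ parity j ⊞ 1ℙ
        c₁-parities = ⊞-cancelʳ (c₁ (pt 0 0)) (begin
          parity (3 + D) ⊞ c₁ (pt 0 0)                   ≡⟨ sym (along-row 0 (3 + D)) ⟩
          c₁ (pt 0 (3 + D))                              ≡⟨ cong c₁ at-j ⟩
          c₁ (pt R j)                                    ≡⟨ same-over-top j ⟩
          c₁ (pt (suc M) j)                              ≡⟨ along-row (suc M) j ⟩
          parity j ⊞ c₁ (pt (suc M) 0)                   ≡⟨ cong (parity j ⊞_) (upward (suc M) ≤-refl) ⟩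
          parity j ⊞ (parity (suc M) ⊞ c₁ (pt 0 0))      ≡⟨ cong (λ z → parity j ⊞ (z ⊞ c₁ (pt 0 0))) 1+M-odd ⟩
          parity j ⊞ (1ℙ ⊞ c₁ (pt 0 0))                  ≡⟨ sym (ℙ.+-assoc (parity j) 1ℙ _) ⟩
          parity j ⊞ 1ℙ ⊞ c₁ (pt 0 0)                    ∎)
        c₂-parities : parity (3 + D) ≡ parity j
        c₂-parities = ⊞-cancelʳ (c₂ (pt (suc M) 0)) (begin
          parity (3 + D) ⊞ c₂ (pt (suc M) 0)             ≡⟨ sym (top-row (3 + D)) ⟩
          c₂ (pt (suc M) (3 + D))                        ≡⟨ unbroken-column ⟩
          parity (suc M) ⊞ c₂ (pt 0 (3 + D))             ≡⟨ cong (_⊞ c₂ (pt 0 (3 + D))) 1+M-odd ⟩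
          c₂ (pt 0 (3 + D)) ⁻¹                           ≡⟨ cong (λ v → c₂ v ⁻¹) (trans at-j (trans (cong (λ z → pt z j) R≡) (sym (pt-t (suc M) j)))) ⟩
          c₂ (pt (suc M) j ⊕ t) ⁻¹                       ≡⟨ cong _⁻¹ (T-flips (over-top _ (row-pt j 1+M<R))) ⟩
          (c₂ (pt (suc M) j) ⁻¹) ⁻¹                      ≡⟨ ⁻¹-involutive _ ⟩
          c₂ (pt (suc M) j)                              ≡⟨ top-row j ⟩
          parity j ⊞ c₂ (pt (suc M) 0)                   ∎)
        clash : ∀ p → p ≢ p ⊞ 1ℙ
        clash 0ℙ ()
        clash 1ℙ ()

      same-above : ∀ v → row v ≡ suc M → c₁ (v ⊕ t) ≡ c₁ v
      same-above v r = let (j , e) = row-reach (pt (suc M) 0) v (trans (row-pt 0 1+M<R) (sym r))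
                           v≡ = trans e (pt-m*s (suc M) j) in
        trans (cong c₁ (trans (cong (_⊕ t) v≡) (trans (pt-t (suc M) j) (cong (λ z → pt z j) (sym R≡)))))
          (trans (same-over-top j) (cong c₁ (sym v≡)))

  -- Odd squares in the three cases

  open Decomposition n-even gen Q-s Q-t S-connected T-connected

  Conclusion : Set
  Conclusion = Σ (Fin n → Fin n) λ H₁ → Σ (Fin n → Fin n) λ H₂ → IsHamDecomp n s t H₁ H₂ × Q₂ n H₁ H₂

  exchanged : c₁ (q 0 ⊕ s) ≡ c₁ (q 0) × c₁ (q M ⊕ s) ≡ c₁ (q M) →
    (∀ l → parity col-order ≡ 0ℙ → (C * s) ≈ (l * t) mod n → parity C ≢ parity l) → Conclusion
  exchanged (first , last) twist = H₁ , H₂ , isHamDecomp ,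
    [ exchanged-square (q 0) (Q-q z≤n) first , exchanged-square (q M) (Q-q ≤-refl) last ]′ (T-Parity.no-flip c₂ T-flips twist)

  closed-rows : R ≡ 1 + M → (∀ l → parity col-order ≡ 0ℙ → (C * s) ≈ (l * t) mod n → parity C ≢ parity l) →
    (∀ l → (R * t) ≈ (l * s) mod n → parity R ≢ parity l) → Conclusion
  closed-rows R≡ twist twist′ = exchanged (S-Parity.closed c₁ S-flips R≡ twist′) twist

  odd-rows : R ≡ 2 + M → (∀ l → parity col-order ≡ 0ℙ → (C * s) ≈ (l * t) mod n → parity C ≢ parity l) →
    parity row-order ≡ 1ℙ → Conclusion
  odd-rows R≡ twist odd = exchanged (S-Parity.Open.odd-rows c₁ S-flips R≡ odd) twist

  even-rows : R ≡ 2 + M → parity row-order ≡ 0ℙ → 4 + D ≤ row-order →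
    (∀ l → (R * t) ≈ (l * s) mod n → parity l ≡ 1ℙ) → Conclusion
  even-rows R≡ even long twist = let (w , r , e) = square in H₁ , H₂ , isHamDecomp ,
    unexchanged-square w (over-top w r) (over-top (w ⊕ s) (trans (row-s w) r)) e (same-above w r)
    where open S-Parity.TopSquare c₁ S-flips R≡ even long twist c₂ T-flips

-- Arithmetic of the jumps

even⇒%2≡0 : ∀ m → parity m ≡ 0ℙ → m % 2 ≡ 0
even⇒%2≡0 m e = go (m % 2) (m%n<n m 2) (trans (parity-%2 m) e)
  where
  go : ∀ k → k < 2 → parity k ≡ 0ℙ → k ≡ 0
  go 0 _ _ = refl
  go (suc (suc _)) (s≤s (s≤s ())) _

even⇒2∣ : ∀ m → parity m ≡ 0ℙ → 2 ∣ m
even⇒2∣ m e = m%n≡0⇒n∣m m 2 (even⇒%2≡0 m e)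

even-∣ : ∀ {d m} → d ∣ m → parity d ≡ 0ℙ → parity m ≡ 0ℙ
even-∣ {d} (divides k refl) e = trans (*-homo-* k d) (trans (cong (parity k ⊠_) e) (ℙ.*-zeroʳ (parity k)))

odd-∣ : ∀ {d m} → d ∣ m → parity m ≡ 1ℙ → parity d ≡ 1ℙ
odd-∣ {d} d∣m odd with parity d in e
... | 1ℙ = refl
... | 0ℙ = contradiction (trans (sym odd) (even-∣ d∣m e)) λ ()

even-gcd : ∀ m n → parity m ≡ 0ℙ → parity n ≡ 0ℙ → parity (gcd m n) ≡ 0ℙ
even-gcd m n em en = even-∣ (gcd-greatest (even⇒2∣ m em) (even⇒2∣ n en)) refl

parity-*-odd : ∀ m n → parity n ≡ 1ℙ → parity (m * n) ≡ parity m
parity-*-odd m n odd = trans (*-homo-* m n) (trans (cong (parity m ⊠_) odd) (ℙ.*-identityʳ (parity m)))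

parity-*-even : ∀ m n → parity n ≡ 0ℙ → parity (m * n) ≡ 0ℙ
parity-*-even m n even = even-∣ (n∣m*n m) even

odd-product⇒odd : ∀ m n → parity (m * n) ≡ 1ℙ → parity m ≡ 1ℙ
odd-product⇒odd m n odd = odd-∣ (m∣m*n {m} n) odd

≈-cancel-* : ∀ {m x y} k .{{_ : NonZero k}} → (x * k) ≈ (y * k) mod (m * k) → x ≈ y mod m
≈-cancel-* {m} {x} {y} k (cong-by p q eq) = cong-by p q (*-cancelʳ-≡ _ _ k (begin
  (x + p * m) * k       ≡⟨ expand x p m k ⟩
  x * k + p * (m * k)   ≡⟨ eq ⟩
  y * k + q * (m * k)   ≡⟨ sym (expand y q m k) ⟩
  (y + q * m) * k       ∎))
  where
  open ≡-Reasoning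
  expand : ∀ x p m k → (x + p * m) * k ≡ x * k + p * (m * k)
  expand = solve-∀

-- Dividing by N leaves h ≡ l (g / N) modulo the even number o.
odd-multiplier : ∀ {n g N} h o l .{{_ : NonZero N}} → N ∣ g → o * N ≡ n → parity o ≡ 0ℙ →
  parity h ≡ 1ℙ → (N * h) ≈ (l * g) mod n → parity l ≡ 1ℙ
odd-multiplier {N = N} h o l (divides g′ refl) refl even odd e =
  odd-product⇒odd l g′ (trans (sym (≈-parity even (≈-cancel-* {o} {h} {l * g′} N
    (≈-trans (≈-reflexive (*-comm h N)) (≈-trans e (≈-reflexive (sym (*-assoc l g′ N)))))))) odd)

SoleCommonDivisor : ℕ → ℕ → ℕ → Set
SoleCommonDivisor n s t = ∀ {d} → d ∣ n → d ∣ s → d ∣ t → d ≡ 1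

-- Jumps preserve residues modulo a common divisor, yet 0 and 1 are connected.
connected⇒coprime : ∀ n .{{_ : NonZero n}} {a b} → Connected n a b → SoleCommonDivisor n a b
connected⇒coprime n {a} {b} connected {d} d∣n d∣a d∣b = ∣1⇒≡1 (≈0⇒∣ (≈-trans (≈-sym (≈-∣ d∣n (toℕ-π-≈ 1)))
  (≈-trans (preserved (connected (π 0) (π 1))) (≈-∣ d∣n (toℕ-π-≈ 0)))))
  where
  open Residues n
  jump : ∀ {k x y} → d ∣ k → PlusJump n k x y → toℕ y ≈ toℕ x mod d
  jump {k} {x} {y} d∣k e = ≈-trans (≈-reflexive (sym e)) (≈-trans (≈-∣ d∣n (%-≈ n (toℕ x + k)))
    (≈-trans (≈-+ {x = toℕ x} ≈-refl (∣⇒≈0 d∣k)) (≈-reflexive (+-identityʳ (toℕ x)))))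
  adjacent : ∀ {x y} → Adj n a b x y → toℕ y ≈ toℕ x mod d
  adjacent {x} {y} (inj₁ e)               = jump {a} {x} {y} d∣a e
  adjacent {x} {y} (inj₂ (inj₁ e))        = ≈-sym (jump {a} {y} {x} d∣a e)
  adjacent {x} {y} (inj₂ (inj₂ (inj₁ e))) = jump {b} {x} {y} d∣b e
  adjacent {x} {y} (inj₂ (inj₂ (inj₂ e))) = ≈-sym (jump {b} {y} {x} d∣b e)
  preserved : ∀ {x y} → Reach n a b x y → toℕ y ≈ toℕ x mod d
  preserved here = ≈-refl
  preserved (step {y} {z} r e) = ≈-trans (adjacent {y} {z} e) (preserved r)

fourRegular⇒generic : ∀ n .{{_ : NonZero n}} {a b} → FourRegularJumps n a b → Exchange.Generic n a b
fourRegular⇒generic n {a} {b} (1≤a , a≤ , 1≤b , b≤ , a≢b , 2a≢0 , 2b≢0) = record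
  { s≉0   = small≉0 1≤a (half<n 1≤a a≤)
  ; t≉0   = small≉0 1≤b (half<n 1≤b b≤)
  ; 2s≉0  = double a 2a≢0
  ; 2t≉0  = double b 2b≢0
  ; s≉t   = λ e → a≢b (trans (sym (m<n⇒m%n≡m (half<n 1≤a a≤))) (trans (≈⇒%≡ n e) (m<n⇒m%n≡m (half<n 1≤b b≤))))
  ; s+t≉0 = small≉0 (≤-trans 1≤a (m≤m+n a b)) a+b<n
  }
  where
  2*half≤n : n / 2 + n / 2 ≤ n
  2*half≤n = ≤-trans (≤-reflexive (trans (sym (cong (n / 2 +_) (+-identityʳ (n / 2)))) (*-comm 2 (n / 2)))) (m/n*n≤m n 2)
  half<n : ∀ {x} → 1 ≤ x → x ≤ n / 2 → x < n
  half<n 1≤x x≤ = ≤-trans (+-monoˡ-≤ _ 1≤x) (≤-trans (+-mono-≤ x≤ x≤) 2*half≤n)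
  small≉0 : ∀ {x} → 1 ≤ x → x < n → ¬ x ≈ 0 mod n
  small≉0 {suc x} _ x<n e = <-irrefl refl (<-≤-trans x<n (∣⇒≤ (≈0⇒∣ e)))
  double : ∀ x → (2 * x) % n ≢ 0 → ¬ (x + x) ≈ 0 mod n
  double x ≢0 e = ≢0 (trans (cong (_% n) (cong (x +_) (+-identityʳ x))) (trans (≈⇒%≡ n e) (m<n⇒m%n≡m (≤-<-trans z≤n (half<n 1≤a a≤)))))
  -- Distinct jumps cannot both attain the bound n / 2.
  a+b<n : a + b < n
  a+b<n with <-cmp a b
  ... | tri< a<b _ _ = <-≤-trans (+-mono-<-≤ (<-≤-trans a<b b≤) b≤) 2*half≤n
  ... | tri≈ _ a≡b _ = contradiction a≡b a≢b
  ... | tri> _ _ b<a = <-≤-trans (+-mono-≤-< a≤ (<-≤-trans b<a a≤)) 2*half≤n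

-- Choice of the parameters

Decomposable : (n : ℕ) .{{_ : NonZero n}} → ℕ → ℕ → Set
Decomposable n s t = Σ (Fin n → Fin n) λ H₁ → Σ (Fin n → Fin n) λ H₂ → IsHamDecomp n s t H₁ H₂ × Q₂ n H₁ H₂

Adj-swap : ∀ n .{{_ : NonZero n}} {s t} x y → Adj n s t x y → Adj n t s x y
Adj-swap n x y (inj₁ e)               = inj₂ (inj₂ (inj₁ e))
Adj-swap n x y (inj₂ (inj₁ e))        = inj₂ (inj₂ (inj₂ e))
Adj-swap n x y (inj₂ (inj₂ (inj₁ e))) = inj₁ e
Adj-swap n x y (inj₂ (inj₂ (inj₂ e))) = inj₂ (inj₁ e)

decomposable-swap : ∀ n .{{_ : NonZero n}} {s t} → Decomposable n s t → Decomposable n t s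
decomposable-swap n (H₁ , H₂ , ((inj₁′ , adj₁) , (inj₂′ , adj₂) , cover , disjoint) , q₂) =
  H₁ , H₂ , ((inj₁′ , λ i j c → Adj-swap n _ _ (adj₁ i j c)) , (inj₂′ , λ i j c → Adj-swap n _ _ (adj₂ i j c)) ,
    (λ x y e → cover x y (Adj-swap n x y e)) , disjoint) , q₂

module Jumps (n : ℕ) .{{_ : NonZero n}} (n-even : parity n ≡ 0ℙ) where
  open Residues n
  open Exchange n

  gcd-nonZero : ∀ g → NonZero (gcd g n)
  gcd-nonZero g = ≢-nonZero (gcd[m,n]≢0 g n (inj₂ (≢-nonZero⁻¹ n)))

  gcd-cosets : ∀ g h → SoleCommonDivisor n g h → Cosets g h (gcd g n)
  gcd-cosets g h sole = cosets g h (proj₁ inv) (gcd g n) {{gcd-nonZero g}} (gcd[m,n]∣m g n) (gcd[m,n]∣n g n) (gcd-multiple g) (proj₂ inv)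
    where
    inv : ∃ λ h̄ → (h * h̄) ≈ 1 mod (gcd g n)
    inv = inverse {{gcd-nonZero g}} λ (d∣h , d∣N) → sole (∣-trans d∣N (gcd[m,n]∣n g n)) (∣-trans d∣N (gcd[m,n]∣m g n)) d∣h

  -- R and C are gcd s n and gcd t n; as variables they keep gcd from unfolding.
  module _ {s t R C : ℕ} (gen : Generic s t) (rows : Cosets s t R) (cols : Cosets t s C)
    (R∣s : R ∣ s) (C∣t : C ∣ t) (C∣n : C ∣ n) (sole : SoleCommonDivisor n s t) (C<R : C < R)
    where

    private
      instance
        R≢0 : NonZero R
        R≢0 = >-nonZero (≤-<-trans z≤n C<R)

    module _ (s-odd : parity s ≡ 1ℙ) (t-even : parity t ≡ 0ℙ) (C-even : parity C ≡ 0ℙ) where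

      -- Both twists come from parities: `C * s ≈ l * t` makes `l` odd while `C` is even, and
      -- `R * t ≈ l * s` makes `l` even while `R` is odd.
      closed-case : ∀ D k → C ≡ 2 + D → suc C + k ≡ R → Decomposable n s t
      closed-case D k refl refl = Construction.closed-rows n n-even s t _ _ D (2 + k) gen rows cols
        C-even k-even (inj₁ (R≡ , refl , s≤s z≤n)) R≡
        (λ l even e p → contradiction (trans (sym C-even) (trans p (odd-multiplier s (Cosets.order cols) l C∣t (Cosets.order*N≡n cols) even s-odd e))) λ ())
        (λ l e p → contradiction (trans (sym (odd-∣ R∣s s-odd)) (trans p (trans (sym (parity-*-odd l s s-odd))
          (trans (sym (≈-parity n-even e)) (parity-*-even (3 + D + k) t t-even))))) λ ())
        where
        R≡ : 3 + D + k ≡ 1 + (D + (2 + k))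
        R≡ = shift D k
          where
          shift : ∀ D k → 3 + D + k ≡ 1 + (D + (2 + k))
          shift = solve-∀
        k-even : parity k ≡ 0ℙ
        k-even = ⁻¹-injective (trans (sym (trans (parity-suc (D + k)) (cong _⁻¹ (trans (+-homo-+ D k) (cong (_⊞ parity k) C-even)))))
          (odd-∣ R∣s s-odd))

    module _ (s-even : parity s ≡ 0ℙ) (t-odd : parity t ≡ 1ℙ) (R-even : parity R ≡ 0ℙ) where

      open Cosets rows using () renaming (order to r; order*N≡n to r*R≡n; order*g≈0 to r*s≈0)

      C-odd : parity C ≡ 1ℙ
      C-odd = odd-∣ C∣t t-odd

      C∣r : C ∣ r
      C∣r = coprime-divisor {C} {R} (λ (d∣C , d∣R) → sole (∣-trans d∣C C∣n) (∣-trans d∣R R∣s) (∣-trans d∣C C∣t))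
        (subst (C ∣_) (trans (sym r*R≡n) (*-comm r R)) C∣n)

      r≢0 : r ≢ 0
      r≢0 r≡0 = ≢-nonZero⁻¹ n (trans (sym r*R≡n) (cong (_* R) r≡0))

      r≢2 : r ≢ 2
      r≢2 r≡2 = Generic.2s≉0 gen (subst (_≈ 0 mod n) (trans (cong (_* s) r≡2) (cong (s +_) (+-identityʳ s))) r*s≈0)

      -- The odd `C` divides the even `r`, so `r` is at least `2 * C`, which suffices for `D ≥ 2`.
      -- For `D = 0` the bound 4 comes from `2s ≉ 0`.
      long-rows : ∀ D → C ≡ suc D → parity D ≡ 0ℙ → parity r ≡ 0ℙ → 4 + D ≤ r
      long-rows zero _ _ r-even = at-least-4 r r≢0 r≢2 r-even
        where
        at-least-4 : ∀ r → r ≢ 0 → r ≢ 2 → parity r ≡ 0ℙ → 4 ≤ r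
        at-least-4 0 r≢0 _ _ = contradiction refl r≢0
        at-least-4 2 _ r≢2 _ = contradiction refl r≢2
        at-least-4 (suc (suc (suc (suc r)))) _ _ _ = s≤s (s≤s (s≤s (s≤s z≤n)))
      long-rows (suc (suc D)) C≡ _ r-even with C∣r
      ... | divides zero r≡ = contradiction r≡ r≢0
      ... | divides 1 r≡ = contradiction (trans (sym C-odd) (trans (cong parity (sym (trans r≡ (+-identityʳ C)))) r-even)) λ ()
      ... | divides (suc (suc x)) r≡ = subst (6 + D ≤_) (sym r≡) (≤-trans (≤-trans (m≤n+m (6 + D) D) (≤-reflexive (twice D)))
              (≤-trans (≤-reflexive (cong₂ _+_ (sym C≡) (sym C≡))) (+-monoʳ-≤ C (m≤m+n C (x * C)))))
        where
        twice : ∀ D → D + (6 + D) ≡ (3 + D) + (3 + D)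
        twice = solve-∀

      -- For odd `r`, `C * s ≈ l * t` makes `l` even against the odd `C`; for even `r`,
      -- `R * t ≈ l * s` makes `l` odd.
      open-case : ∀ D k → C ≡ suc D → suc C + k ≡ R → Decomposable n s t
      open-case D k refl refl = by-parity (parity r) refl
        where
        D-even : parity D ≡ 0ℙ
        D-even = ⁻¹-injective (trans (sym (parity-suc D)) C-odd)
        k-even : parity k ≡ 0ℙ
        k-even = trans (sym (trans (+-homo-+ D k) (cong (_⊞ parity k) D-even))) R-even
        by-parity : ∀ p → parity r ≡ p → Decomposable n s t
        by-parity 1ℙ r-odd = Construction.odd-rows n n-even s t _ _ D k gen rows cols D-even k-even (inj₂ (refl , refl)) refl
          (λ l _ e p → contradiction (trans (sym C-odd) (trans p (trans (sym (parity-*-odd l t t-odd))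
            (trans (sym (≈-parity n-even e)) (parity-*-even (suc D) s s-even))))) λ ()) r-odd
        by-parity 0ℙ r-even = Construction.even-rows n n-even s t _ _ D k gen rows cols D-even k-even (inj₂ (refl , refl)) refl
          r-even (long-rows D refl D-even r-even) (λ l e → odd-multiplier t r l R∣s r*R≡n r-even t-odd e)

  -- One gcd is even and the other odd, so they differ; the jump with the larger gcd takes the role
  -- of the rows.
  even-odd : ∀ {s t} → Generic s t → SoleCommonDivisor n s t → parity s ≡ 0ℙ → parity t ≡ 1ℙ → Decomposable n s t
  even-odd {s} {t} gen sole s-even t-odd = by-size λ e → contradiction (trans (sym (odd-∣ (gcd[m,n]∣m t n) t-odd)) (trans (cong parity e) R-even)) λ ()
    where
    sole′ : SoleCommonDivisor n t s
    sole′ d∣n d∣t d∣s = sole d∣n d∣s d∣t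
    R-even : parity (gcd s n) ≡ 0ℙ
    R-even = even-gcd s n s-even n-even

    rows-even : ∀ R C → Cosets s t R → Cosets t s C → R ∣ s → C ∣ t → C ∣ n → parity R ≡ 0ℙ → C < R → Decomposable n s t
    rows-even R zero rows cols R∣s C∣t C∣n R-even C<R = contradiction (odd-∣ C∣t t-odd) λ ()
    rows-even R (suc D) rows cols R∣s C∣t C∣n R-even C<R with m≤n⇒∃[o]m+o≡n C<R
    ... | k , eq = open-case gen rows cols R∣s C∣t C∣n sole C<R s-even t-odd R-even D k refl eq

    rows-odd : ∀ R C → Cosets t s R → Cosets s t C → R ∣ t → C ∣ s → C ∣ n → parity C ≡ 0ℙ → C < R → Decomposable n t s
    rows-odd R zero rows cols R∣t C∣s C∣n C-even C<R with C∣n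
    ... | divides k n≡ = contradiction (trans n≡ (*-zeroʳ k)) (≢-nonZero⁻¹ n)
    rows-odd R (suc (suc D)) rows cols R∣t C∣s C∣n C-even C<R with m≤n⇒∃[o]m+o≡n C<R
    ... | k , eq = closed-case (generic-swap gen) rows cols R∣t C∣s C∣n sole′ C<R t-odd s-even C-even D k refl eq

    by-size : ¬ gcd t n ≡ gcd s n → Decomposable n s t
    by-size C≢R with gcd t n <? gcd s n
    ... | yes C<R = rows-even (gcd s n) (gcd t n) (gcd-cosets s t sole) (gcd-cosets t s sole′)
      (gcd[m,n]∣m s n) (gcd[m,n]∣m t n) (gcd[m,n]∣n t n) R-even C<R
    ... | no  C≮R = decomposable-swap n (rows-odd (gcd t n) (gcd s n) (gcd-cosets t s sole′) (gcd-cosets s t sole)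
      (gcd[m,n]∣m t n) (gcd[m,n]∣m s n) (gcd[m,n]∣n s n) R-even (≤∧≢⇒< (≮⇒≥ C≮R) (≢-sym C≢R)))

theorem2p13 : (n a b : ℕ) .{{_ : NonZero n}} →
    FourRegularJumps n a b →
    Connected n a b →
    n % 2 ≡ 0 →
    a % 2 ≢ b % 2 →
    Σ (Fin n → Fin n) λ H₁ → Σ (Fin n → Fin n) λ H₂ →
    IsHamDecomp n a b H₁ H₂ × Q₂ n H₁ H₂
theorem2p13 n a b regular connected n%2≡0 a%2≢b%2 = by-parity (parity a) (parity b) refl refl
  where
  n-even : parity n ≡ 0ℙ
  n-even = %2≡0⇒even n n%2≡0
  open Jumps n n-even
  gen : Exchange.Generic n a b
  gen = fourRegular⇒generic n regular
  sole : SoleCommonDivisor n a b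
  sole = connected⇒coprime n connected
  by-parity : ∀ p q → parity a ≡ p → parity b ≡ q → Decomposable n a b
  by-parity 0ℙ 1ℙ a-even b-odd = even-odd gen sole a-even b-odd
  by-parity 1ℙ 0ℙ a-odd b-even = decomposable-swap n
    (even-odd (Exchange.generic-swap n gen) (λ d∣n d∣b d∣a → sole d∣n d∣a d∣b) b-even a-odd)
  by-parity 0ℙ 0ℙ a-even b-even = contradiction (trans (even⇒%2≡0 a a-even) (sym (even⇒%2≡0 b b-even))) a%2≢b%2
  by-parity 1ℙ 1ℙ a-odd b-odd = contradiction (trans (odd⇒%2≡1 a a-odd) (sym (odd⇒%2≡1 b b-odd))) a%2≢b%2
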